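{- Let $k\ge 4$ and $n\ge k$ be integers, and let $G$ be a connected $k$-chromatic graph of order $n$ with $G\notin\mathcal{C}^*_k(n)$. Then $$\frac{1}{(x)_{\downarrow k}}\,\pi(G,x)<(x-1)^{n-k}$$ for every real number $x> n-2+\left(\binom{n}{2}-\binom{k}{2}-n+k\right)^2$.
   Context: All graphs are finite and simple. $\pi(G,x)$ denotes the chromatic polynomial of $G$. $(x)_{\downarrow k}=x(x-1)\cdots(x-k+1)$ is the falling factorial. A graph is $k$-chromatic if its chromatic number is $k$. $\mathcal{C}^*_k(n)$ denotes the set of connected $k$-chromatic graphs of order $n$ that have exactly $\binom{k}{2}+n-k$ edges and clique number $k$ (equivalently, graphs obtained from $K_k$ by repeatedly attaching a new vertex of degree one). -}

module Defs where

open import Level using (0ℓ)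
open import Data.Nat as ℕ using (ℕ; zero; suc; _∸_; _<ᵇ_)
open import Data.Integer as ℤ using (ℤ; +_; -[1+_])
open import Data.Fin using (Fin; toℕ) renaming (zero to fz; suc to fs)
open import Data.Fin as Fin using ()
open import Data.Bool using (Bool; true; false; _∧_; not; if_then_else_)
open import Data.List using (List; []; _∷_; [_]; map; concatMap; allFin; foldr)
open import Data.Product using (Σ; _×_; _,_)
open import Relation.Nullary using (¬_; does)
open import Relation.Binary.PropositionalEquality using (_≡_; _≢_)
open import Relation.Binary.Structures using (IsStrictTotalOrder)
open import Algebra.Bundles using (CommutativeRing)
open import Function.Definitions using (Injective)
open import Data.Nat.Combinatorics using (_C_)

record Graph (n : ℕ) : Set where
  field
    adj    : Fin n → Fin n → Bool
    sym    : ∀ i j → adj i j ≡ adj j i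
    irrefl : ∀ i → adj i i ≡ false
open Graph public

data Reach {n : ℕ} (G : Graph n) : Fin n → Fin n → Set where
  here : ∀ {i} → Reach G i i
  step : ∀ {i j l} → adj G i j ≡ true → Reach G j l → Reach G i l

Connected : ∀ {n} → Graph n → Set
Connected G = ∀ i j → Reach G i j

Proper : ∀ {n m} → Graph n → (Fin n → Fin m) → Set
Proper G c = ∀ i j → adj G i j ≡ true → c i ≢ c j

Colorable : ∀ {n} → Graph n → ℕ → Set
Colorable {n} G m = Σ (Fin n → Fin m) (Proper G)

ChromaticNumber : ∀ {n} → Graph n → ℕ → Set
ChromaticNumber G k = Colorable G k × (∀ m → m ℕ.< k → ¬ Colorable G m)

HasClique : ∀ {n} → Graph n → ℕ → Set
HasClique {n} G s =
  Σ (Fin s → Fin n) λ f → Injective _≡_ _≡_ f × (∀ a b → a ≢ b → adj G (f a) (f b) ≡ true)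

CliqueNumber : ∀ {n} → Graph n → ℕ → Set
CliqueNumber G k = HasClique G k × ¬ HasClique G (suc k)

countB : {A : Set} → (A → Bool) → List A → ℕ
countB p = foldr (λ a r → if p a then suc r else r) 0

numEdges : ∀ {n} → Graph n → ℕ
numEdges {n} G =
  foldr (λ i r → countB (λ j → adj G i j ∧ (toℕ i <ᵇ toℕ j)) (allFin n) ℕ.+ r) 0 (allFin n)

allB : {A : Set} → (A → Bool) → List A → Bool
allB p = foldr (λ a r → p a ∧ r) true

consF : ∀ {n m} → Fin m → (Fin n → Fin m) → Fin (suc n) → Fin m
consF a c fz = a
consF a c (fs i) = c i

allMaps : ∀ n m → List (Fin n → Fin m)
allMaps zero m = [ (λ ()) ]
allMaps (suc n) m = concatMap (λ c → map (λ a → consF a c) (allFin m)) (allMaps n m)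

isProperB : ∀ {n m} → Graph n → (Fin n → Fin m) → Bool
isProperB {n} G c =
  allB (λ i → allB (λ j → not (adj G i j ∧ does (c i Fin.≟ c j))) (allFin n)) (allFin n)

numColorings : ∀ {n} → Graph n → ℕ → ℕ
numColorings {n} G m = countB (isProperB G) (allMaps n m)

InCstar : (k n : ℕ) → Graph n → Set
InCstar k n G =
  Connected G × ChromaticNumber G k × (numEdges G ≡ k C 2 ℕ.+ (n ∸ k)) × CliqueNumber G k

evalℤ : List ℤ → ℤ → ℤ
evalℤ []       x = + 0
evalℤ (a ∷ as) x = a ℤ.+ x ℤ.* evalℤ as x

-- P is the chromatic polynomial of G: it agrees with the number of
-- proper m-colourings for every natural m (this determines P as a
-- polynomial function).
IsChromaticPoly : ∀ {n} → Graph n → List ℤ → Set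
IsChromaticPoly G P = ∀ (m : ℕ) → evalℤ P (+ m) ≡ + numColorings G m

-- Ordered fields (the real numbers are one)

record OrderedField : Set₁ where
  field
    commRing : CommutativeRing 0ℓ 0ℓ
  open CommutativeRing commRing public
  field
    _<_            : Carrier → Carrier → Set
    isSTO          : IsStrictTotalOrder _≈_ _<_
    +-mono-<       : ∀ {x y} z → x < y → (x + z) < (y + z)
    *-pos          : ∀ {x y} → 0# < x → 0# < y → 0# < (x * y)
    nontrivial     : ¬ (0# ≈ 1#)
    inverse        : ∀ x → ¬ (x ≈ 0#) → Σ Carrier λ y → (x * y) ≈ 1#

module _ (F : OrderedField) where
  open OrderedField F

  fromℕ : ℕ → Carrier
  fromℕ zero    = 0#
  fromℕ (suc m) = 1# + fromℕ m

  fromℤ : ℤ → Carrier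
  fromℤ (+ m)      = fromℕ m
  fromℤ -[1+ m ]   = - fromℕ (suc m)

  evalF : List ℤ → Carrier → Carrier
  evalF []       x = 0#
  evalF (a ∷ as) x = fromℤ a + x * evalF as x

  falling : Carrier → ℕ → Carrier
  falling x zero    = 1#
  falling x (suc j) = falling x j * (x - fromℕ j)

  pow : Carrier → ℕ → Carrier
  pow x zero    = 1#
  pow x (suc j) = pow x j * x

{-# OPTIONS --safe #-}

-- Edges.  Repeatedly discarding vertices of degree < k − 1 keeps a graph that is not (k − 1)-colourable,
-- so it ends in a nonempty vertex set S all of whose induced degrees are ≥ k − 1.  By connectivity the other
-- n − |S| vertices contribute an edge each, hence 2 e(G) ≥ |S| (k − 1) + 2 (n − |S|).  As k ≥ 4 this exceeds
-- 2 (C(k,2) + n − k) unless |S| = k, in which case S is a k-clique.  So G has at least one edge more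
-- than the graphs of C*_k(n), that is, fewer than D := C(n,2) − C(k,2) − n + k non-edges.
--
-- Polynomial.  Colouring the vertices one at a time, each new vertex either opens a colour class or joins one
-- of the existing classes in which it has no neighbour.  This gives an integer polynomial, which agrees with the
-- given one since both take the same values on ℕ.  Every join uses up a non-edge; with y = x − (n − 2) and e
-- non-edges the recursion yields π(G,x) ≤ (x)_{n−1} (y (1 + 1/y)^e − 1).  Since e < D and y > D², this is less
-- than (x)_{n−1} (y − 1 + D), which is a lower bound for (x)_k (x − 1)^{n−k} by induction on n.
module Submission where

open import Defs hiding (sym)
open import Algebra.Solver.Ring.AlmostCommutativeRing using (fromCommutativeRing; _-Raw-AlmostCommutative⟶_)
open import Data.Bool using (Bool; true; false; _∧_; _∨_; not; if_then_else_)
open import Data.Bool.Properties using (∧-zeroʳ; ∧-identityʳ; ¬-not) renaming (_≟_ to _≟ᵇ_)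
open import Data.Fin using (Fin; toℕ; _≟_) renaming (zero to fz; suc to fs)
open import Data.Fin.Properties using (any?; all?; ¬∀⟶∃¬; pigeonhole; <⇒≢; suc-injective)
open import Data.Integer as ℤ using (ℤ; +_; -[1+_])
open import Data.List using (List; []; _∷_; map; _++_; concatMap; tabulate; allFin; foldr)
open import Data.List.Relation.Unary.All using (All; []; _∷_)
open import Data.Maybe using (Maybe; just; nothing)
open import Data.Nat using (ℕ; zero; suc; _+_; _*_; _∸_; _≤_; _<_; z≤n; s≤s; _<ᵇ_; _≤?_)
open import Data.Nat.Combinatorics using (_C_; nCk+nC[k+1]≡[n+1]C[k+1]; nC1≡n)
open import Data.Nat.Divisibility using (_∣_; divides; ∣⇒≤)
open import Data.Nat.Properties hiding (_≟_; <⇒≢; suc-injective)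
open import Data.Nat.Tactic.RingSolver using (solve-∀)
open import Data.Product using (Σ; ∃; _×_; _,_; proj₁; proj₂)
open import Data.Sum using (inj₁; inj₂)
open import Function using (_∘_; id)
open import Function.Definitions using (Injective)
open import Relation.Binary using (IsStrictTotalOrder; StrictPartialOrder; tri<; tri≈; tri>)
open import Relation.Binary.PropositionalEquality
  using (_≡_; _≢_; refl; sym; trans; cong; cong₂; subst; module ≡-Reasoning)
open import Relation.Nullary using (¬_; Dec; yes; no; does; contradiction)
open import Relation.Nullary.Decidable using (_×-dec_; ¬?; dec-true; dec-false; decidable-stable)
import Algebra.Properties.Ring as RingProperties
import Algebra.Solver.Ring as RingSolver
import Data.Integer.Properties as ℤ
import Data.Integer.Tactic.RingSolver as ℤSolver
import Relation.Binary.Construct.StrictToNonStrict as ToNonStrict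
import Relation.Binary.Reasoning.StrictPartialOrder as OrderReasoning
open import Algebra.Properties.CommutativeMonoid.Sum +-0-commutativeMonoid
  using (sum; ∑-comm; ∑-distrib-+; sum-cong-≗)
import Algebra.Properties.CommutativeMonoid.Sum ℤ.+-0-commutativeMonoid as ℤSum

private variable
  n m r k : ℕ

-- Finite sums of natural numbers and indicators.

⟦_⟧ : Bool → ℕ
⟦ true ⟧ = 1
⟦ false ⟧ = 0

sum-mono : {f g : Fin n → ℕ} → (∀ i → f i ≤ g i) → sum f ≤ sum g
sum-mono {zero}  h = z≤n
sum-mono {suc n} h = +-mono-≤ (h fz) (sum-mono (h ∘ fs))

sum-const : ∀ n c → sum {n} (λ _ → c) ≡ n * c
sum-const zero    c = refl
sum-const (suc n) c = cong (_+_ c) (sum-const n c)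

term≤sum : (f : Fin n → ℕ) (i : Fin n) → f i ≤ sum f
term≤sum f fz     = m≤m+n (f fz) _
term≤sum f (fs i) = ≤-trans (term≤sum (f ∘ fs) i) (m≤n+m _ (f fz))

sum-δ : (i : Fin n) → sum (λ j → ⟦ does (i ≟ j) ⟧) ≡ 1
sum-δ {suc n} fz     = cong suc (trans (sum-const n 0) (*-zeroʳ n))
sum-δ {suc n} (fs i) = sum-δ i

+-sum-δ : (f : Fin n → ℕ) (i : Fin n) → sum f + 1 ≡ sum (λ j → f j + ⟦ does (i ≟ j) ⟧)
+-sum-δ f i = trans (cong (_+_ (sum f)) (sym (sum-δ i))) (sym (∑-distrib-+ f _))

-- Double counting of pairs (a, j) with j in `p` coloured a: if every colour occurred, the pairs
-- would number at least m, yet each vertex of `p` lies in only one of them.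
missing-colour : (p : Fin n → Bool) (c : Fin n → Fin m) → sum (⟦_⟧ ∘ p) < m →
  ∃ λ a → ∀ j → p j ≡ true → c j ≢ a
missing-colour {n} {m} p c few
  with any? (λ a → all? (λ j → ¬? ((p j ≟ᵇ true) ×-dec (c j ≟ a))))
... | yes (a , free) = a , λ j pj cj → free j (pj , cj)
... | no  none = contradiction few (≤⇒≯ m≤sum)
  where
  open ≤-Reasoning
  used : ∀ a → 1 ≤ sum (λ j → ⟦ p j ∧ does (c j ≟ a) ⟧)
  used a with ¬∀⟶∃¬ n _ (λ j → ¬? ((p j ≟ᵇ true) ×-dec (c j ≟ a))) (λ all → none (a , all))
  ... | j , ¬¬j with decidable-stable ((p j ≟ᵇ true) ×-dec (c j ≟ a)) ¬¬j
  ... | pj , cj = subst (_≤ _) (cong ⟦_⟧ (cong₂ _∧_ pj (dec-true (c j ≟ a) cj)))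
                          (term≤sum (λ j → ⟦ p j ∧ does (c j ≟ a) ⟧) j)
  once : ∀ j → sum (λ a → ⟦ p j ∧ does (c j ≟ a) ⟧) ≤ ⟦ p j ⟧
  once j with p j
  ... | true  = ≤-reflexive (sum-δ (c j))
  ... | false = ≤-reflexive (trans (sum-const m 0) (*-zeroʳ m))
  m≤sum : m ≤ sum (⟦_⟧ ∘ p)
  m≤sum = begin
    m                                                   ≡⟨ *-identityʳ m ⟨
    m * 1                                               ≡⟨ sum-const m 1 ⟨
    sum {m} (λ _ → 1)                                   ≤⟨ sum-mono used ⟩
    sum (λ a → sum (λ j → ⟦ p j ∧ does (c j ≟ a) ⟧))    ≡⟨ ∑-comm (λ a j → ⟦ p j ∧ does (c j ≟ a) ⟧) ⟩
    sum (λ j → sum (λ a → ⟦ p j ∧ does (c j ≟ a) ⟧))    ≤⟨ sum-mono once ⟩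
    sum (⟦_⟧ ∘ p)                                       ∎

-- Vertex sets, colourings on them, and cores of large minimum degree.

size : (Fin n → Bool) → ℕ
size S = sum (⟦_⟧ ∘ S)

degIn : Graph n → (Fin n → Bool) → Fin n → ℕ
degIn G S v = size (λ j → S j ∧ adj G v j)

ColorableOn : Graph n → (Fin n → Bool) → ℕ → Set
ColorableOn {n} G S m = Σ (Fin n → Fin m) λ c →
  ∀ i j → S i ≡ true → S j ≡ true → adj G i j ≡ true → c i ≢ c j

delete insert : (Fin n → Bool) → Fin n → Fin n → Bool
delete S v j = S j ∧ not (does (v ≟ j))
insert S v j = S j ∨ does (v ≟ j)

size-delete : (S : Fin n → Bool) (v : Fin n) → S v ≡ true → size (delete S v) + 1 ≡ size S
size-delete S v Sv = trans (+-sum-δ (⟦_⟧ ∘ delete S v) v) (sum-cong-≗ pointwise)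
  where
  pointwise : ∀ j → ⟦ delete S v j ⟧ + ⟦ does (v ≟ j) ⟧ ≡ ⟦ S j ⟧
  pointwise j with v ≟ j
  ... | yes refl rewrite Sv = refl
  ... | no  _    with S j
  ...   | true  = refl
  ...   | false = refl

size-insert : (S : Fin n → Bool) (v : Fin n) → S v ≡ false → size S + 1 ≡ size (insert S v)
size-insert S v Sv = trans (+-sum-δ (⟦_⟧ ∘ S) v) (sum-cong-≗ pointwise)
  where
  pointwise : ∀ j → ⟦ S j ⟧ + ⟦ does (v ≟ j) ⟧ ≡ ⟦ insert S v j ⟧
  pointwise j with v ≟ j
  ... | yes refl rewrite Sv = refl
  ... | no  _    with S j
  ...   | true  = refl
  ...   | false = refl

extend-colouring : (G : Graph n) (S : Fin n → Bool) (v : Fin n) → degIn G S v < m →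
  ColorableOn G (delete S v) m → ColorableOn G S m
extend-colouring {n} {m} G S v low (c , proper) = c′ , proper′
  where
  new : ∃ λ a → ∀ j → S j ∧ adj G v j ≡ true → c j ≢ a
  new = missing-colour (λ j → S j ∧ adj G v j) c low
  c′ : Fin n → Fin m
  c′ j = if does (v ≟ j) then proj₁ new else c j
  proper′ : ∀ i j → S i ≡ true → S j ≡ true → adj G i j ≡ true → c′ i ≢ c′ j
  proper′ i j Si Sj ij with v ≟ i in vi | v ≟ j in vj
  ... | yes refl | yes refl = λ _ → case (trans (sym ij) (irrefl G i))
    where case : true ≢ false
          case ()
  ... | yes refl | no _ = λ e → proj₂ new j (cong₂ _∧_ Sj ij) (sym e)
  ... | no _ | yes refl = proj₂ new i (cong₂ _∧_ Si (trans (Graph.sym G j i) ij))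
  ... | no _ | no _ = proper i j (in-delete i Si vi) (in-delete j Sj vj) ij
    where
    in-delete : ∀ l {q} → S l ≡ true → (v ≟ l) ≡ no q → delete S v l ≡ true
    in-delete l Sl e rewrite Sl | e = refl

-- By `extend-colouring`, deleting a vertex of degree at most m in S preserves non-colourability, so
-- deletion continues until no such vertex is left. The set reached is nonempty because the empty
-- set is colourable; writing the number of colours as `suc m` supplies the constant map for this.
-- `fuel` makes the recursion structural.
core : (G : Graph n) (m : ℕ) (S : Fin n → Bool) (fuel : ℕ) → size S ≤ fuel →
  ¬ ColorableOn G S (suc m) →
  ∃ λ S′ → (∃ λ v → S′ v ≡ true) × (∀ v → S′ v ≡ true → suc m ≤ degIn G S′ v)
core G m S fuel bound uncol
  with any? (λ v → (S v ≟ᵇ true) ×-dec (suc (degIn G S v) ≤? suc m))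
... | no  none = S , nonempty , λ v Sv → ≮⇒≥ (λ low → none (v , Sv , low))
  where
  nonempty : ∃ λ v → S v ≡ true
  nonempty with any? (λ v → S v ≟ᵇ true)
  ... | yes w = w
  ... | no  e = contradiction ((λ _ → fz) , λ i _ Si _ _ _ → e (i , Si)) uncol
core G m S zero bound uncol | yes (v , Sv , low) =
  contradiction (≤-trans (≤-reflexive (trans (+-comm 1 _) (size-delete S v Sv))) bound) λ ()
core G m S (suc fuel) bound uncol | yes (v , Sv , low) =
  core G m (delete S v) fuel
    (≤-pred (≤-trans (≤-reflexive (trans (+-comm 1 _) (size-delete S v Sv))) bound))
    (uncol ∘ extend-colouring G S v low)

-- Edges counted by their ends.

-- Each edge inside S counts twice, once from either end, so the count is a sum of degrees and needs
-- no order on the vertices.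
edgeEnds : Graph n → (Fin n → Bool) → ℕ
edgeEnds G S = sum λ i → sum λ j → ⟦ S i ∧ S j ∧ adj G i j ⟧

exit-edge : (G : Graph n) (S : Fin n → Bool) {i l : Fin n} → Reach G i l →
  S i ≡ true → S l ≡ false → ∃ λ u → ∃ λ w → S u ≡ true × S w ≡ false × adj G u w ≡ true
exit-edge G S here Si Sl = contradiction (trans (sym Si) Sl) λ ()
exit-edge G S (step {i} {j} ij path) Si Sl with S j in Sj
... | true  = exit-edge G S path Sj Sl
... | false = i , j , Si , Sj , ij

-- The ordered pairs (u, w) and (w, u) are new. They lie in different rows, as u is in S and w is
-- not, and so add one to the row of each.
edgeEnds-insert : (G : Graph n) (S : Fin n → Bool) {u w : Fin n} →
  S u ≡ true → S w ≡ false → adj G u w ≡ true → edgeEnds G S + 2 ≤ edgeEnds G (insert S w)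
edgeEnds-insert {n} G S {u} {w} Su Sw uw = begin
  edgeEnds G S + 2                                 ≡⟨ +-assoc (edgeEnds G S) 1 1 ⟨
  edgeEnds G S + 1 + 1                             ≡⟨ cong (_+ 1) (+-sum-δ old u) ⟩
  sum (λ i → old i + ⟦ does (u ≟ i) ⟧) + 1         ≡⟨ +-sum-δ (λ i → old i + ⟦ does (u ≟ i) ⟧) w ⟩
  sum (λ i → old i + ⟦ does (u ≟ i) ⟧ + ⟦ does (w ≟ i) ⟧) ≤⟨ sum-mono row ⟩
  edgeEnds G (insert S w)                          ∎
  where
  open ≤-Reasoning
  old new : Fin n → ℕ
  old i = sum λ j → ⟦ S i ∧ S j ∧ adj G i j ⟧
  new i = sum λ j → ⟦ insert S w i ∧ insert S w j ∧ adj G i j ⟧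
  entry : ∀ i j → ⟦ S i ∧ S j ∧ adj G i j ⟧ ≤ ⟦ insert S w i ∧ insert S w j ∧ adj G i j ⟧
  entry i j with S i | S j
  ... | true  | true  = ≤-refl
  ... | true  | false = z≤n
  ... | false | _     = z≤n
  row-u : old u + 1 ≤ new u
  row-u = ≤-trans (≤-reflexive (+-sum-δ (λ j → ⟦ S u ∧ S j ∧ adj G u j ⟧) w)) (sum-mono pointwise)
    where
    pointwise : ∀ j → ⟦ S u ∧ S j ∧ adj G u j ⟧ + ⟦ does (w ≟ j) ⟧ ≤
                      ⟦ insert S w u ∧ insert S w j ∧ adj G u j ⟧
    pointwise j with w ≟ j
    ... | yes refl rewrite Su | Sw | uw = ≤-refl
    ... | no  _    rewrite Su with S j
    ...   | true  = ≤-reflexive (+-identityʳ _)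
    ...   | false = z≤n
  row-w : old w + 1 ≤ new w
  row-w = ≤-trans (≤-reflexive (+-sum-δ (λ j → ⟦ S w ∧ S j ∧ adj G w j ⟧) u)) (sum-mono pointwise)
    where
    pointwise : ∀ j → ⟦ S w ∧ S j ∧ adj G w j ⟧ + ⟦ does (u ≟ j) ⟧ ≤
                      ⟦ insert S w w ∧ insert S w j ∧ adj G w j ⟧
    pointwise j rewrite Sw with u ≟ j
    ... | no  _    = z≤n
    ... | yes refl rewrite Su | dec-true (w ≟ w) refl | trans (Graph.sym G w u) uw = ≤-refl
  by-cases : ∀ i (p : Dec (u ≡ i)) (q : Dec (w ≡ i)) → old i + ⟦ does p ⟧ + ⟦ does q ⟧ ≤ new i
  by-cases i (yes refl) (yes refl) = contradiction (trans (sym Su) Sw) λ ()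
  by-cases i (yes refl) (no _)     = subst (_≤ new i) (sym (+-identityʳ _)) row-u
  by-cases i (no _)     (yes refl) = subst (λ z → z + 1 ≤ new i) (sym (+-identityʳ _)) row-w
  by-cases i (no _)     (no _)     =
    subst (_≤ new i) (sym (trans (+-identityʳ _) (+-identityʳ _))) (sum-mono (entry i))
  row : ∀ i → old i + ⟦ does (u ≟ i) ⟧ + ⟦ does (w ≟ i) ⟧ ≤ new i
  row i = by-cases i (u ≟ i) (w ≟ i)

-- Connectivity lets S absorb the remaining t vertices one at a time, each along a new edge.
edgeEnds-grow : (G : Graph n) → Connected G → (S : Fin n → Bool) (t : ℕ) →
  size S + t ≡ n → (∃ λ v → S v ≡ true) → edgeEnds G S + 2 * t ≤ edgeEnds G (λ _ → true)
edgeEnds-grow G conn S zero    eq ne =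
  subst (_≤ _) (sym (+-identityʳ _)) (sum-mono λ i → sum-mono λ j → entry i j)
  where
  entry : ∀ i j → ⟦ S i ∧ S j ∧ adj G i j ⟧ ≤ ⟦ adj G i j ⟧
  entry i j with S i | S j
  ... | true  | true  = ≤-refl
  ... | true  | false = z≤n
  ... | false | _     = z≤n
edgeEnds-grow {n} G conn S (suc t) eq (v , Sv) with any? (λ w → S w ≟ᵇ false)
... | no  full = contradiction eq (λ e → m+1+n≢m n (subst (λ z → z + suc t ≡ n) sizeS e))
  where
  sizeS : size S ≡ n
  sizeS = trans (sum-cong-≗ λ j → cong ⟦_⟧ (¬-not (λ Sj → full (j , Sj)))) (trans (sum-const n 1) (*-identityʳ n))
... | yes (w₀ , Sw₀) with exit-edge G S (conn v w₀) Sv Sw₀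
...   | u , w , Su , Sw , uw = begin
  edgeEnds G S + 2 * suc t          ≡⟨ cong (_+_ (edgeEnds G S)) (*-suc 2 t) ⟩
  edgeEnds G S + (2 + 2 * t)        ≡⟨ +-assoc (edgeEnds G S) 2 (2 * t) ⟨
  edgeEnds G S + 2 + 2 * t          ≤⟨ +-monoˡ-≤ (2 * t) (edgeEnds-insert G S Su Sw uw) ⟩
  edgeEnds G (insert S w) + 2 * t   ≤⟨ edgeEnds-grow G conn (insert S w) t eq′ (v , cong (_∨ _) Sv) ⟩
  edgeEnds G (λ _ → true)           ∎
  where
  open ≤-Reasoning
  eq′ : size (insert S w) + t ≡ n
  eq′ = trans (cong (_+ t) (sym (size-insert S w Sw))) (trans (+-assoc (size S) 1 t) eq)

degree-sum : (G : Graph n) (S : Fin n → Bool) (d : ℕ) →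
  (∀ v → S v ≡ true → d ≤ degIn G S v) → size S * d ≤ edgeEnds G S
degree-sum {n} G S d h = ≤-trans (≤-reflexive (lhs S)) (sum-mono row)
  where
  lhs : ∀ {n} (S : Fin n → Bool) → size S * d ≡ sum (λ i → ⟦ S i ⟧ * d)
  lhs {zero}  S = refl
  lhs {suc n} S = trans (*-distribʳ-+ d ⟦ S fz ⟧ _) (cong (_+_ (⟦ S fz ⟧ * d)) (lhs (S ∘ fs)))
  row : ∀ i → ⟦ S i ⟧ * d ≤ sum (λ j → ⟦ S i ∧ S j ∧ adj G i j ⟧)
  row i with S i in Si
  ... | true  = subst (_≤ _) (sym (+-identityʳ d)) (h i Si)
  ... | false = z≤n

-- Degrees inside a set, and cliques.

degIn<size : (G : Graph n) (S : Fin n → Bool) (v : Fin n) → S v ≡ true → degIn G S v + 1 ≤ size S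
degIn<size G S v Sv = ≤-trans (≤-reflexive (+-sum-δ _ v)) (sum-mono pointwise)
  where
  pointwise : ∀ j → ⟦ S j ∧ adj G v j ⟧ + ⟦ does (v ≟ j) ⟧ ≤ ⟦ S j ⟧
  pointwise j with v ≟ j
  ... | yes refl rewrite Sv | irrefl G v = ≤-refl
  ... | no  _    with S j | adj G v j
  ...   | true  | true  = ≤-refl
  ...   | true  | false = z≤n
  ...   | false | _     = z≤n

-- Both v and w belong to S without being neighbours of v.
nonadjacent⇒degIn+2≤size : (G : Graph n) (S : Fin n → Bool) (v w : Fin n) → v ≢ w →
  S v ≡ true → S w ≡ true → adj G v w ≡ false → degIn G S v + 1 + 1 ≤ size S
nonadjacent⇒degIn+2≤size G S v w v≢w Sv Sw vw =
  ≤-trans (≤-reflexive (trans (cong (_+ 1) (+-sum-δ _ v)) (+-sum-δ _ w))) (sum-mono pointwise)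
  where
  pointwise : ∀ j → ⟦ S j ∧ adj G v j ⟧ + ⟦ does (v ≟ j) ⟧ + ⟦ does (w ≟ j) ⟧ ≤ ⟦ S j ⟧
  pointwise j with v ≟ j | w ≟ j
  ... | yes refl | yes refl = contradiction refl v≢w
  ... | yes refl | no _     rewrite Sv | irrefl G v = ≤-refl
  ... | no _     | yes refl rewrite Sw | vw = ≤-refl
  ... | no _     | no _     with S j | adj G v j
  ...   | true  | true  = ≤-refl
  ...   | true  | false = z≤n
  ...   | false | _     = z≤n

enumerate : (S : Fin n → Bool) → size S ≡ k →
  Σ (Fin k → Fin n) λ f → Injective _≡_ _≡_ f × (∀ a → S (f a) ≡ true)
enumerate {zero}  S refl = (λ ()) , (λ { {()} }) , λ ()
enumerate {suc n} S eq with S fz in S0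
enumerate {suc n} S refl | true with enumerate (S ∘ fs) refl
... | f , inj , mem = f′ , inj′ , mem′
  where
  f′ : Fin (suc (size (S ∘ fs))) → Fin (suc n)
  f′ fz     = fz
  f′ (fs a) = fs (f a)
  inj′ : Injective _≡_ _≡_ f′
  inj′ {fz}   {fz}   _    = refl
  inj′ {fs a} {fs b} e    = cong fs (inj (suc-injective e))
  mem′ : ∀ a → S (f′ a) ≡ true
  mem′ fz     = S0
  mem′ (fs a) = mem a
enumerate {suc n} S eq | false with enumerate (S ∘ fs) eq
... | f , inj , mem = fs ∘ f , (λ e → inj (suc-injective e)) , mem

-- A non-adjacent pair in S would leave one of its members at most k - 1 neighbours among the k + 1
-- vertices of S.
full-degree⇒clique : (G : Graph n) (S : Fin n → Bool) → size S ≡ suc k →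
  (∀ v → S v ≡ true → k ≤ degIn G S v) → HasClique G (suc k)
full-degree⇒clique {k = k} G S eq deg with enumerate S eq
... | f , inj , mem = f , inj , λ a b a≢b → ¬-not λ nonadj →
  <-irrefl refl (begin-strict
    k                       ≤⟨ deg (f a) (mem a) ⟩
    degIn G S (f a)         <⟨ ≤-reflexive (+-comm 1 _) ⟩
    degIn G S (f a) + 1     ≤⟨ +-cancelʳ-≤ 1 _ _ (≤-trans (missed a b a≢b nonadj) (≤-reflexive (trans eq (+-comm 1 k)))) ⟩
    k                       ∎)
  where
  open ≤-Reasoning
  missed : ∀ a b → a ≢ b → adj G (f a) (f b) ≡ false → degIn G S (f a) + 1 + 1 ≤ size S
  missed a b a≢b = nonadjacent⇒degIn+2≤size G S (f a) (f b) (a≢b ∘ inj) (mem a) (mem b)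

colorable⇒no-larger-clique : (G : Graph n) → Colorable G k → ¬ HasClique G (suc k)
colorable⇒no-larger-clique {k = k} G (c , proper) (f , _ , adjacent)
  with pigeonhole (n<1+n k) (c ∘ f)
... | a , b , a<b , same = proper (f a) (f b) (adjacent a b (<⇒≢ a<b)) same

-- The number of edges, by removal of the first vertex.

tailG : Graph (suc n) → Graph n
tailG G = record
  { adj    = λ i j → adj G (fs i) (fs j)
  ; sym    = λ i j → Graph.sym G (fs i) (fs j)
  ; irrefl = λ i → irrefl G (fs i)
  }

countB-tabulate : {A : Set} (p : A → Bool) (g : Fin n → A) → countB p (tabulate g) ≡ size (p ∘ g)
countB-tabulate {zero}  p g = refl
countB-tabulate {suc n} p g with p (g fz)
... | true  = cong suc (countB-tabulate p (g ∘ fs))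
... | false = countB-tabulate p (g ∘ fs)

foldr-+-tabulate : {A : Set} (f : A → ℕ) (g : Fin n → A) →
  foldr (λ a s → f a + s) 0 (tabulate g) ≡ sum (f ∘ g)
foldr-+-tabulate {zero}  f g = refl
foldr-+-tabulate {suc n} f g = cong (_+_ (f (g fz))) (foldr-+-tabulate f (g ∘ fs))

numEdges-as-sum : (G : Graph n) →
  numEdges G ≡ sum λ i → size λ j → adj G i j ∧ (toℕ i <ᵇ toℕ j)
numEdges-as-sum {n} G = trans (foldr-+-tabulate (λ i → countB (forward i) (allFin n)) id)
                              (sum-cong-≗ λ i → countB-tabulate (forward i) id)
  where
  forward : Fin n → Fin n → Bool
  forward i j = adj G i j ∧ (toℕ i <ᵇ toℕ j)

-- Vertex 0 precedes every other vertex, so its edges are all counted in its own row and never in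
-- another.
numEdges-suc : (G : Graph (suc n)) → numEdges G ≡ size (λ j → adj G fz (fs j)) + numEdges (tailG G)
numEdges-suc {n} G = begin
  numEdges G
    ≡⟨ numEdges-as-sum G ⟩
  (⟦ adj G fz fz ∧ false ⟧ + size (λ j → adj G fz (fs j) ∧ true))
    + sum (λ i → ⟦ adj G (fs i) fz ∧ false ⟧ + size (λ j → adj (tailG G) i j ∧ (toℕ i <ᵇ toℕ j)))
    ≡⟨ cong₂ _+_ (cong₂ _+_ (cong ⟦_⟧ (∧-zeroʳ (adj G fz fz))) (sum-cong-≗ λ j → cong ⟦_⟧ (∧-identityʳ (adj G fz (fs j)))))
                 (sum-cong-≗ λ i → cong (λ b → ⟦ b ⟧ + size (λ j → adj (tailG G) i j ∧ (toℕ i <ᵇ toℕ j)))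
                                        (∧-zeroʳ (adj G (fs i) fz))) ⟩
  size (λ j → adj G fz (fs j)) + sum (λ i → size (λ j → adj (tailG G) i j ∧ (toℕ i <ᵇ toℕ j)))
    ≡⟨ cong (_+_ (size (λ j → adj G fz (fs j)))) (numEdges-as-sum (tailG G)) ⟨
  size (λ j → adj G fz (fs j)) + numEdges (tailG G) ∎
  where open ≡-Reasoning

handshake : (G : Graph n) → edgeEnds G (λ _ → true) ≡ 2 * numEdges G
handshake {zero}  G = refl
handshake {suc n} G = begin
  (⟦ adj G fz fz ⟧ + d) + sum (λ i → ⟦ adj G (fs i) fz ⟧ + size (adj (tailG G) i))
    ≡⟨ cong₂ _+_ (cong (λ b → ⟦ b ⟧ + d) (irrefl G fz)) (∑-distrib-+ (λ i → ⟦ adj G (fs i) fz ⟧) _) ⟩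
  d + (size (λ i → adj G (fs i) fz) + edgeEnds (tailG G) (λ _ → true))
    ≡⟨ cong (_+_ d) (cong₂ _+_ (sum-cong-≗ λ i → cong ⟦_⟧ (Graph.sym G (fs i) fz)) (handshake (tailG G))) ⟩
  d + (d + 2 * numEdges (tailG G))
    ≡⟨ arith d (numEdges (tailG G)) ⟩
  2 * (d + numEdges (tailG G))
    ≡⟨ cong (2 *_) (numEdges-suc G) ⟨
  2 * numEdges G ∎
  where
  open ≡-Reasoning
  d = size (λ j → adj G fz (fs j))
  arith : ∀ a b → a + (a + 2 * b) ≡ 2 * (a + b)
  arith = solve-∀

-- The lower bound for the number of edges.

suc-C-2 : ∀ n → suc n C 2 ≡ n + n C 2
suc-C-2 n = trans (sym (nCk+nC[k+1]≡[n+1]C[k+1] n 1)) (cong (_+ n C 2) (nC1≡n n))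

2*C-2 : ∀ n → 2 * (suc n C 2) ≡ suc n * n
2*C-2 zero    = refl
2*C-2 (suc n) = begin
  2 * (suc (suc n) C 2)       ≡⟨ cong (2 *_) (suc-C-2 (suc n)) ⟩
  2 * (suc n + suc n C 2)     ≡⟨ *-distribˡ-+ 2 (suc n) _ ⟩
  2 * suc n + 2 * (suc n C 2) ≡⟨ cong (_+_ (2 * suc n)) (2*C-2 n) ⟩
  2 * suc n + suc n * n       ≡⟨ arith n ⟩
  suc (suc n) * suc n         ∎
  where
  open ≡-Reasoning
  arith : ∀ n → 2 * suc n + suc n * n ≡ suc (suc n) * suc n
  arith = solve-∀

-- The core S has minimum degree at least k - 1, and connectivity adds two edge ends per vertex
-- outside S. The resulting bound on 2 e(G) is compared with the claim according to how far |S|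
-- exceeds k.
numEdges-lower-bound : 4 ≤ k → k ≤ n → (G : Graph n) → Connected G → ChromaticNumber G k →
  ¬ InCstar k n G → k C 2 + (n ∸ k) < numEdges G
numEdges-lower-bound {suc (suc m)} {n} (s≤s (s≤s 2≤m)) k≤n G conn (col , uncol) notC
  with core G m (λ _ → true) (size {n} (λ _ → true)) ≤-refl
         (λ (c , p) → uncol (suc m) ≤-refl (c , λ i j → p i j refl refl))
... | S , (v , Sv) , deg = result (n ∸ size S) (m+[n∸m]≡n size≤n) (m≤n⇒∃ k≤size)
  where
  open ≤-Reasoning
  k′ = suc m
  e = numEdges G
  m≤n⇒∃ : ∀ {a b} → a ≤ b → ∃ λ d → b ≡ a + d
  m≤n⇒∃ {a} {b} p = b ∸ a , sym (m+[n∸m]≡n p)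
  size≤n : size S ≤ n
  size≤n = ≤-trans (sum-mono {g = λ _ → 1} bit≤1) (≤-reflexive (trans (sum-const n 1) (*-identityʳ n)))
    where
    bit≤1 : ∀ j → ⟦ S j ⟧ ≤ 1
    bit≤1 j with S j
    ... | true  = ≤-refl
    ... | false = z≤n
  k≤size : suc k′ ≤ size S
  k≤size = ≤-trans (s≤s (deg v Sv)) (≤-trans (≤-reflexive (+-comm 1 _)) (degIn<size G S v Sv))
  -- `t` vertices lie outside the core, and the core has `a` vertices more than k = `suc k′`.
  result : ∀ t → size S + t ≡ n → (∃ λ a → size S ≡ suc k′ + a) → suc k′ C 2 + (n ∸ suc k′) < e
  result t st (a , sa) = by-excess a sa
    where
    ends : size S * k′ + 2 * t ≤ 2 * e
    ends = ≤-trans (+-monoˡ-≤ (2 * t) (degree-sum G S k′ deg))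
             (≤-trans (edgeEnds-grow G conn S t st (v , Sv)) (≤-reflexive (handshake G)))
    n∸k : ∀ a → size S ≡ suc k′ + a → n ∸ suc k′ ≡ a + t
    n∸k a sa = trans (cong (_∸ suc k′) (trans (sym st) (trans (cong (_+ t) sa) (+-assoc (suc k′) a t))))
                     (m+n∸m≡n (suc k′) (a + t))
    by-excess : ∀ a → size S ≡ suc k′ + a → suc k′ C 2 + (n ∸ suc k′) < e
    -- Here the core is a k-clique. Counting gives only the weak inequality, and equality would put
    -- G into the excluded class.
    by-excess zero sa = ≤∧≢⇒< (*-cancelˡ-≤ 2 (begin
        2 * (suc k′ C 2 + (n ∸ suc k′))   ≡⟨ cong (λ z → 2 * (suc k′ C 2 + z)) (n∸k 0 sa) ⟩
        2 * (suc k′ C 2 + t)              ≡⟨ *-distribˡ-+ 2 (suc k′ C 2) t ⟩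
        2 * (suc k′ C 2) + 2 * t          ≡⟨ cong (_+ 2 * t) (2*C-2 k′) ⟩
        suc k′ * k′ + 2 * t               ≡⟨ cong (λ z → z * k′ + 2 * t) (trans sa (+-identityʳ _)) ⟨
        size S * k′ + 2 * t               ≤⟨ ends ⟩
        2 * e                             ∎))
      (λ eq → notC (conn , (col , uncol) , sym eq ,
                    full-degree⇒clique G S (trans sa (+-identityʳ _)) deg ,
                    colorable⇒no-larger-clique G col))
    by-excess (suc a) sa = *-cancelˡ-< 2 _ _ (begin-strict
        2 * (suc k′ C 2 + (n ∸ suc k′))          ≡⟨ cong (λ z → 2 * (suc k′ C 2 + z)) (n∸k (suc a) sa) ⟩
        2 * (suc k′ C 2 + (suc a + t))           ≡⟨ expand (suc k′ C 2) (suc a) t ⟩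
        2 * (suc k′ C 2) + 2 * suc a + 2 * t     ≡⟨ cong (λ z → z + 2 * suc a + 2 * t) (2*C-2 k′) ⟩
        -- Here k ≥ 4 enters as 2 < k - 1: each surplus core vertex contributes k - 1 edge ends
        -- where the claim asks for 2.
        suc k′ * k′ + 2 * suc a + 2 * t          <⟨ +-monoˡ-< (2 * t) (+-monoʳ-< (suc k′ * k′) (*-monoˡ-< (suc a) (s≤s 2≤m))) ⟩
        suc k′ * k′ + k′ * suc a + 2 * t         ≡⟨ collect k′ (suc a) t ⟩
        (suc k′ + suc a) * k′ + 2 * t            ≡⟨ cong (λ z → z * k′ + 2 * t) sa ⟨
        size S * k′ + 2 * t                      ≤⟨ ends ⟩
        2 * e                                    ∎)
      where
      expand : ∀ c a t → 2 * (c + (a + t)) ≡ 2 * c + 2 * a + 2 * t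
      expand = solve-∀
      collect : ∀ k a t → suc k * k + k * a + 2 * t ≡ (suc k + a) * k + 2 * t
      collect = solve-∀

-- Proper colourings counted vertex by vertex.

conj : (Fin n → Bool) → Bool
conj {zero}  p = true
conj {suc n} p = p fz ∧ conj (p ∘ fs)

conj-cong : {p q : Fin n → Bool} → (∀ i → p i ≡ q i) → conj p ≡ conj q
conj-cong {zero}  h = refl
conj-cong {suc n} h = cong₂ _∧_ (h fz) (conj-cong (h ∘ fs))

conj-∧ : (p q : Fin n → Bool) → conj (λ i → p i ∧ q i) ≡ conj p ∧ conj q
conj-∧ {zero}  p q = refl
conj-∧ {suc n} p q rewrite conj-∧ (p ∘ fs) (q ∘ fs) with p fz | q fz | conj (p ∘ fs)
... | true  | true  | _     = refl
... | true  | false | true  = refl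
... | true  | false | false = refl
... | false | _     | _     = refl

conj-true : ∀ n → conj {n} (λ _ → true) ≡ true
conj-true zero    = refl
conj-true (suc n) = conj-true n

allB-tabulate : {A : Set} (p : A → Bool) (g : Fin n → A) → allB p (tabulate g) ≡ conj (p ∘ g)
allB-tabulate {zero}  p g = refl
allB-tabulate {suc n} p g = cong (p (g fz) ∧_) (allB-tabulate p (g ∘ fs))

proper : Graph n → (Fin n → Fin m) → Bool
proper G c = conj λ i → conj λ j → not (adj G i j ∧ does (c i ≟ c j))

isProperB≡proper : (G : Graph n) (c : Fin n → Fin m) → isProperB G c ≡ proper G c
isProperB≡proper {n} G c =
  trans (allB-tabulate (λ i → allB (λ j → not (adj G i j ∧ does (c i ≟ c j))) (allFin n)) id)
        (conj-cong λ i → allB-tabulate (λ j → not (adj G i j ∧ does (c i ≟ c j))) id)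

≟-swap : (a b : Fin m) → does (a ≟ b) ≡ does (b ≟ a)
≟-swap a b with a ≟ b
... | yes refl = sym (dec-true (a ≟ a) refl)
... | no  a≢b  = sym (dec-false (b ≟ a) (a≢b ∘ sym))

respects : (Fin n → Fin m → Bool) → (Fin n → Fin m) → Bool
respects allow c = conj λ i → allow i (c i)

exclude : Graph (suc n) → (Fin (suc n) → Fin m → Bool) → Fin m → Fin n → Fin m → Bool
exclude G allow a i b = allow (fs i) b ∧ not (adj G fz (fs i) ∧ does (a ≟ b))

-- Once vertex 0 has colour a, its edges are accounted for by striking a from the lists of its
-- neighbours, so the condition on the remaining vertices has the same shape.
proper-consF : (G : Graph (suc n)) (allow : Fin (suc n) → Fin m → Bool) (a : Fin m) (c : Fin n → Fin m) →
  proper G (consF a c) ∧ respects allow (consF a c) ≡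
  allow fz a ∧ (proper (tailG G) c ∧ respects (exclude G allow a) c)
proper-consF {n} G allow a c
  rewrite irrefl G fz
        | conj-∧ (λ i → not (adj G (fs i) fz ∧ does (c i ≟ a)))
                 (λ i → conj λ j → not (adj (tailG G) i j ∧ does (c i ≟ c j)))
        | conj-cong {n} {λ i → not (adj G (fs i) fz ∧ does (c i ≟ a))} {λ i → not (adj G fz (fs i) ∧ does (a ≟ c i))}
            (λ i → cong not (cong₂ _∧_ (Graph.sym G (fs i) fz) (≟-swap (c i) a)))
        | conj-∧ (λ i → allow (fs i) (c i)) (λ i → not (adj G fz (fs i) ∧ does (a ≟ c i)))
  = shuffle (conj λ i → not (adj G fz (fs i) ∧ does (a ≟ c i))) (proper (tailG G) c) (allow fz a) _
  where
  -- `x` occurs twice on the left because each edge at vertex 0 is tested from both of its ends.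
  shuffle : ∀ x y u z → (x ∧ (x ∧ y)) ∧ (u ∧ z) ≡ u ∧ (y ∧ (z ∧ x))
  shuffle true  true  true  true  = refl
  shuffle true  true  true  false = refl
  shuffle true  true  false _     = refl
  shuffle true  false true  _     = refl
  shuffle true  false false _     = refl
  shuffle false true  true  true  = refl
  shuffle false true  true  false = refl
  shuffle false true  false _     = refl
  shuffle false false true  _     = refl
  shuffle false false false _     = refl

countB-∷ : {A : Set} (p : A → Bool) (a : A) (l : List A) → countB p (a ∷ l) ≡ ⟦ p a ⟧ + countB p l
countB-∷ p a l with p a
... | true  = refl
... | false = refl

countB-cong : {A : Set} {p q : A → Bool} (l : List A) → (∀ a → p a ≡ q a) → countB p l ≡ countB q l
countB-cong []      h = refl
countB-cong {p = p} {q} (a ∷ l) h =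
  trans (countB-∷ p a l) (trans (cong₂ _+_ (cong ⟦_⟧ (h a)) (countB-cong l h)) (sym (countB-∷ q a l)))

countB-false : {A : Set} (l : List A) → countB (λ _ → false) l ≡ 0
countB-false []      = refl
countB-false (a ∷ l) = countB-false l

countB-map-tabulate : {A B : Set} (p : B → Bool) (f : A → B) (g : Fin n → A) (l : List B) →
  countB p (map f (tabulate g) ++ l) ≡ size (λ i → p (f (g i))) + countB p l
countB-map-tabulate {zero}  p f g l = refl
countB-map-tabulate {suc n} p f g l = begin
  countB p (f (g fz) ∷ map f (tabulate (g ∘ fs)) ++ l)
    ≡⟨ countB-∷ p (f (g fz)) (map f (tabulate (g ∘ fs)) ++ l) ⟩
  ⟦ p (f (g fz)) ⟧ + countB p (map f (tabulate (g ∘ fs)) ++ l)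
    ≡⟨ cong (_+_ (⟦ p (f (g fz)) ⟧)) (countB-map-tabulate p f (g ∘ fs) l) ⟩
  ⟦ p (f (g fz)) ⟧ + (size (λ i → p (f (g (fs i)))) + countB p l)
    ≡⟨ +-assoc ⟦ p (f (g fz)) ⟧ _ _ ⟨
  size (λ i → p (f (g i))) + countB p l ∎
  where open ≡-Reasoning

countB-consF : (p : (Fin (suc n) → Fin m) → Bool) (L : List (Fin n → Fin m)) →
  countB p (concatMap (λ c → map (λ a → consF a c) (allFin m)) L) ≡
  sum (λ a → countB (λ c → p (consF a c)) L)
countB-consF {m = m} p []      = sym (trans (sum-const m 0) (*-zeroʳ m))
countB-consF {m = m} p (c ∷ L) = begin
  countB p (map (λ a → consF a c) (allFin m) ++ concatMap (λ c → map (λ a → consF a c) (allFin m)) L)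
    ≡⟨ countB-map-tabulate p (λ a → consF a c) id _ ⟩
  size (λ a → p (consF a c)) + countB p (concatMap (λ c → map (λ a → consF a c) (allFin m)) L)
    ≡⟨ cong (_+_ (size (λ a → p (consF a c)))) (countB-consF p L) ⟩
  size (λ a → p (consF a c)) + sum (λ a → countB (λ c → p (consF a c)) L)
    ≡⟨ ∑-distrib-+ (λ a → ⟦ p (consF a c) ⟧) (λ a → countB (λ c → p (consF a c)) L) ⟨
  sum (λ a → ⟦ p (consF a c) ⟧ + countB (λ c → p (consF a c)) L)
    ≡⟨ sum-cong-≗ (λ a → countB-∷ (λ c → p (consF a c)) c L) ⟨
  sum (λ a → countB (λ c → p (consF a c)) (c ∷ L)) ∎
  where open ≡-Reasoning

-- Lists of allowed colours make the recursion close: colouring vertex 0 leaves a smaller graph,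
-- again with a list at each vertex.
listColourings : Graph n → (Fin n → Fin m → Bool) → ℕ
listColourings {zero}  G allow = 1
listColourings {suc n} G allow =
  sum λ a → if allow fz a then listColourings (tailG G) (exclude G allow a) else 0

countB≡listColourings : (G : Graph n) (allow : Fin n → Fin m → Bool) →
  countB (λ c → proper G c ∧ respects allow c) (allMaps n m) ≡ listColourings G allow
countB≡listColourings {zero}          G allow = refl
countB≡listColourings {suc n} {m} G allow =
  trans (countB-consF (λ c → proper G c ∧ respects allow c) (allMaps n m)) (sum-cong-≗ choose)
  where
  choose : ∀ a → countB (λ c → proper G (consF a c) ∧ respects allow (consF a c)) (allMaps n m) ≡
               (if allow fz a then listColourings (tailG G) (exclude G allow a) else 0)
  choose a = trans (countB-cong (allMaps n m) (proper-consF G allow a)) rest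
    where
    rest : countB (λ c → allow fz a ∧ (proper (tailG G) c ∧ respects (exclude G allow a) c)) (allMaps n m) ≡
           (if allow fz a then listColourings (tailG G) (exclude G allow a) else 0)
    rest with allow fz a
    ... | true  = countB≡listColourings (tailG G) (exclude G allow a)
    ... | false = countB-false (allMaps n m)

numColorings≡listColourings : (G : Graph n) (m : ℕ) → numColorings G m ≡ listColourings {m = m} G (λ _ _ → true)
numColorings≡listColourings {n} G m = trans (countB-cong (allMaps n m) unrestricted) (countB≡listColourings G _)
  where
  unrestricted : ∀ c → isProperB G c ≡ proper G c ∧ respects {m = m} (λ _ _ → true) c
  unrestricted c = trans (isProperB≡proper G c)
    (sym (trans (cong (proper G c ∧_) (conj-true n)) (∧-identityʳ (proper G c))))

-- Integer polynomials as coefficient lists.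

addP : List ℤ → List ℤ → List ℤ
addP []      q       = q
addP (a ∷ p) []      = a ∷ p
addP (a ∷ p) (b ∷ q) = (a ℤ.+ b) ∷ addP p q

scaleP : ℤ → List ℤ → List ℤ
scaleP c = map (c ℤ.*_)

timesX- : ℕ → List ℤ → List ℤ
timesX- r p = addP (+ 0 ∷ p) (scaleP (ℤ.- + r) p)

sumP : (Fin r → List ℤ) → List ℤ
sumP {zero}  f = []
sumP {suc r} f = addP (f fz) (sumP (f ∘ fs))

evalℤ-addP : ∀ p q x → evalℤ (addP p q) x ≡ evalℤ p x ℤ.+ evalℤ q x
evalℤ-addP []      q       x = sym (ℤ.+-identityˡ _)
evalℤ-addP (a ∷ p) []      x = sym (ℤ.+-identityʳ _)
evalℤ-addP (a ∷ p) (b ∷ q) x rewrite evalℤ-addP p q x = arith a b x (evalℤ p x) (evalℤ q x)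
  where
  arith : ∀ a b x u v → a ℤ.+ b ℤ.+ x ℤ.* (u ℤ.+ v) ≡ a ℤ.+ x ℤ.* u ℤ.+ (b ℤ.+ x ℤ.* v)
  arith = ℤSolver.solve-∀

evalℤ-scaleP : ∀ c p x → evalℤ (scaleP c p) x ≡ c ℤ.* evalℤ p x
evalℤ-scaleP c []      x = sym (ℤ.*-zeroʳ c)
evalℤ-scaleP c (a ∷ p) x rewrite evalℤ-scaleP c p x = arith c a x (evalℤ p x)
  where
  arith : ∀ c a x u → c ℤ.* a ℤ.+ x ℤ.* (c ℤ.* u) ≡ c ℤ.* (a ℤ.+ x ℤ.* u)
  arith = ℤSolver.solve-∀

evalℤ-timesX- : ∀ r p x → evalℤ (timesX- r p) x ≡ (x ℤ.- + r) ℤ.* evalℤ p x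
evalℤ-timesX- r p x = trans (evalℤ-addP (+ 0 ∷ p) (scaleP (ℤ.- + r) p) x)
  (trans (cong (ℤ._+_ (+ 0 ℤ.+ x ℤ.* evalℤ p x)) (evalℤ-scaleP (ℤ.- + r) p x)) (arith x (+ r) (evalℤ p x)))
  where
  arith : ∀ x r u → + 0 ℤ.+ x ℤ.* u ℤ.+ (ℤ.- r) ℤ.* u ≡ (x ℤ.- r) ℤ.* u
  arith = ℤSolver.solve-∀

evalℤ-sumP : (f : Fin r → List ℤ) (x : ℤ) → evalℤ (sumP f) x ≡ ℤSum.sum (λ b → evalℤ (f b) x)
evalℤ-sumP {zero}  f x = refl
evalℤ-sumP {suc r} f x = trans (evalℤ-addP (f fz) _ x) (cong (ℤ._+_ (evalℤ (f fz) x)) (evalℤ-sumP (f ∘ fs) x))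

-- If p vanishes at every positive integer m, then m divides the constant coefficient for every m.
vanishing⇒zero : ∀ p → (∀ m → evalℤ p (+ suc m) ≡ + 0) → All (_≡ + 0) p
vanishing⇒zero []      h = []
vanishing⇒zero (a ∷ p) h = a≡0 ∷ vanishing⇒zero p p-vanishes
  where
  a≡ : ∀ m → a ≡ + suc m ℤ.* (ℤ.- evalℤ p (+ suc m))
  a≡ m = trans (arith a (+ suc m) (evalℤ p (+ suc m))) 
    (trans (cong (λ z → z ℤ.+ + suc m ℤ.* (ℤ.- evalℤ p (+ suc m))) (h m)) (ℤ.+-identityˡ _))
    where
    arith : ∀ a x u → a ≡ a ℤ.+ x ℤ.* u ℤ.+ x ℤ.* (ℤ.- u)
    arith = ℤSolver.solve-∀
  divisible : ∀ m → suc m ∣ ℤ.∣ a ∣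
  divisible m = divides ℤ.∣ ℤ.- evalℤ p (+ suc m) ∣
    (trans (cong ℤ.∣_∣ (a≡ m)) (trans (ℤ.abs-* (+ suc m) (ℤ.- evalℤ p (+ suc m))) (*-comm (suc m) _)))
  a≡0 : a ≡ + 0
  a≡0 with ℤ.∣ a ∣ in eq | divisible ℤ.∣ a ∣
  ... | zero  | _ = ℤ.∣i∣≡0⇒i≡0 eq
  ... | suc s | d = contradiction (∣⇒≤ d) 1+n≰n
  p-vanishes : ∀ m → evalℤ p (+ suc m) ≡ + 0
  p-vanishes m = ℤ.*-cancelˡ-≡ (+ suc m) _ _
    (trans (sym (ℤ.+-identityˡ _)) (trans (cong (λ z → z ℤ.+ + suc m ℤ.* evalℤ p (+ suc m)) (sym a≡0))
      (trans (h m) (sym (ℤ.*-zeroʳ (+ suc m))))))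

-- The chromatic polynomial by opening and joining colour classes.

openBlock : Graph (suc n) → (Fin r → Fin (suc n) → Bool) → Fin (suc r) → Fin n → Bool
openBlock G forb fz     i = adj G fz (fs i)
openBlock G forb (fs b) i = forb b (fs i)

joinBlock : Graph (suc n) → (Fin r → Fin (suc n) → Bool) → Fin r → Fin r → Fin n → Bool
joinBlock G forb b b′ i = forb b′ (fs i) ∨ (adj G fz (fs i) ∧ does (b ≟ b′))

-- The number of extensions of a colouring of already processed vertices, whose r colour classes
-- carry distinct colours, to the vertices of G; forb b i says that vertex i has a neighbour in class b.
extensionPoly : Graph n → (Fin r → Fin n → Bool) → List ℤ
extensionPoly {zero}      G forb = + 1 ∷ []
extensionPoly {suc n} {r} G forb =
  addP (timesX- r (extensionPoly (tailG G) (openBlock G forb)))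
       (sumP λ b → if forb b fz then [] else extensionPoly (tailG G) (joinBlock G forb b))

sum-single : (i : Fin m) (x : ℤ) → ℤSum.sum (λ j → if does (i ≟ j) then x else + 0) ≡ x
sum-single {suc m} fz     x = trans (cong (ℤ._+_ x) (ℤSum.sum-replicate-zero m)) (ℤ.+-identityʳ x)
sum-single {suc m} (fs i) x = trans (ℤ.+-identityˡ _) (sum-single i x)

-- Induction on r: overwriting h by K at the first point `g₀` of the image changes the sum by K - h
-- `g₀` and gives a function that equals K off the remaining image. Working over ℤ avoids a proof
-- that m ≥ r.
sum-outside-image : (h : Fin m → ℤ) (K : ℤ) (g : Fin r → Fin m) → Injective _≡_ _≡_ g →
  (∀ a → (∀ b → g b ≢ a) → h a ≡ K) →
  ℤSum.sum h ≡ (+ m ℤ.- + r) ℤ.* K ℤ.+ ℤSum.sum (h ∘ g)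
sum-outside-image {m} {zero} h K g inj out =
  trans (ℤSum.sum-cong-≗ λ a → out a λ ()) (trans (const m) (arith (+ m) K))
  where
  arith : ∀ m K → m ℤ.* K ≡ (m ℤ.- + 0) ℤ.* K ℤ.+ + 0
  arith = ℤSolver.solve-∀
  const : ∀ m → ℤSum.sum {m} (λ _ → K) ≡ + m ℤ.* K
  const zero    = sym (ℤ.*-zeroˡ K)
  const (suc m) = trans (cong (ℤ._+_ K) (const m)) (sym (ℤ.suc-* (+ m) K))
sum-outside-image {m} {suc r} h K g inj out = begin
  ℤSum.sum h                                    ≡⟨ cancel (ℤSum.sum h) K ⟩
  ℤSum.sum h ℤ.+ K ℤ.- K                        ≡⟨ cong (λ z → z ℤ.- K) exchange ⟩
  ℤSum.sum h′ ℤ.+ h g₀ ℤ.- K                    ≡⟨ cong (λ s → s ℤ.+ h g₀ ℤ.- K) rec ⟩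
  (+ m ℤ.- + r) ℤ.* K ℤ.+ ℤSum.sum (h ∘ g ∘ fs) ℤ.+ h g₀ ℤ.- K
                                                ≡⟨ arith (+ m) (+ r) K _ (h g₀) ⟩
  (+ m ℤ.- (+ 1 ℤ.+ + r)) ℤ.* K ℤ.+ (h g₀ ℤ.+ ℤSum.sum (h ∘ g ∘ fs)) ∎
  where
  open ≡-Reasoning
  g₀ = g fz
  h′ : Fin m → ℤ
  h′ a = if does (g₀ ≟ a) then K else h a
  cancel : ∀ s K → s ≡ s ℤ.+ K ℤ.- K
  cancel = ℤSolver.solve-∀
  arith : ∀ m r K s u → (m ℤ.- r) ℤ.* K ℤ.+ s ℤ.+ u ℤ.- K ≡ (m ℤ.- (+ 1 ℤ.+ r)) ℤ.* K ℤ.+ (u ℤ.+ s)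
  arith = ℤSolver.solve-∀
  swap-at : ∀ a → h a ℤ.+ (if does (g₀ ≟ a) then K else + 0) ≡ h′ a ℤ.+ (if does (g₀ ≟ a) then h g₀ else + 0)
  swap-at a with g₀ ≟ a
  ... | yes refl = ℤ.+-comm (h a) K
  ... | no  _    = refl
  exchange : ℤSum.sum h ℤ.+ K ≡ ℤSum.sum h′ ℤ.+ h g₀
  exchange = begin
    ℤSum.sum h ℤ.+ K
      ≡⟨ cong (ℤ._+_ (ℤSum.sum h)) (sum-single g₀ K) ⟨
    ℤSum.sum h ℤ.+ ℤSum.sum (λ a → if does (g₀ ≟ a) then K else + 0)
      ≡⟨ ℤSum.∑-distrib-+ h _ ⟨
    ℤSum.sum (λ a → h a ℤ.+ (if does (g₀ ≟ a) then K else + 0))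
      ≡⟨ ℤSum.sum-cong-≗ swap-at ⟩
    ℤSum.sum (λ a → h′ a ℤ.+ (if does (g₀ ≟ a) then h g₀ else + 0))
      ≡⟨ ℤSum.∑-distrib-+ h′ _ ⟩
    ℤSum.sum h′ ℤ.+ ℤSum.sum (λ a → if does (g₀ ≟ a) then h g₀ else + 0)
      ≡⟨ cong (ℤ._+_ (ℤSum.sum h′)) (sum-single g₀ (h g₀)) ⟩
    ℤSum.sum h′ ℤ.+ h g₀ ∎
  out′ : ∀ a → (∀ b → g (fs b) ≢ a) → h′ a ≡ K
  out′ a avoid with g₀ ≟ a
  ... | yes _    = refl
  ... | no  g₀≢a = out a λ { fz → g₀≢a ; (fs b) → avoid b }
  on-image : ∀ b → h′ (g (fs b)) ≡ h (g (fs b))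
  on-image b with g₀ ≟ g (fs b)
  ... | yes e = contradiction (inj e) λ ()
  ... | no  _ = refl
  rec : ℤSum.sum h′ ≡ (+ m ℤ.- + r) ℤ.* K ℤ.+ ℤSum.sum (h ∘ g ∘ fs)
  rec = trans (sum-outside-image h′ K (g ∘ fs) (suc-injective ∘ inj) out′)
              (cong (ℤ._+_ ((+ m ℤ.- + r) ℤ.* K)) (ℤSum.sum-cong-≗ on-image))

+-sum : (f : Fin n → ℕ) → + sum f ≡ ℤSum.sum (λ i → + f i)
+-sum {zero}  f = refl
+-sum {suc n} f = trans (ℤ.pos-+ (f fz) _) (cong (ℤ._+_ (+ f fz)) (+-sum (f ∘ fs)))

-- `g` gives each class its colour; the hypotheses say that the lists forbid exactly the class
-- colours recorded in `forb`. For vertex 0 the m - r fresh colours all lead to the same count, that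
-- of opening a class, and each used colour is a join, so `sum-outside-image` reproduces the
-- recursion of the polynomial.
extensionPoly-counts : (G : Graph n) (forb : Fin r → Fin n → Bool) (allow : Fin n → Fin m → Bool)
  (g : Fin r → Fin m) → Injective _≡_ _≡_ g →
  (∀ i b → allow i (g b) ≡ not (forb b i)) → (∀ i a → (∀ b → g b ≢ a) → allow i a ≡ true) →
  evalℤ (extensionPoly G forb) (+ m) ≡ + listColourings G allow
extensionPoly-counts {zero}          {m = m} G forb allow g inj on off = cong (ℤ._+_ (+ 1)) (ℤ.*-zeroʳ (+ m))
extensionPoly-counts {suc n} {r} {m} G forb allow g inj on off = begin
  evalℤ (extensionPoly G forb) (+ m)
    ≡⟨ evalℤ-addP (timesX- r opened) (sumP joined) (+ m) ⟩
  evalℤ (timesX- r opened) (+ m) ℤ.+ evalℤ (sumP joined) (+ m)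
    ≡⟨ cong₂ ℤ._+_ (evalℤ-timesX- r opened (+ m)) (evalℤ-sumP joined (+ m)) ⟩
  (+ m ℤ.- + r) ℤ.* evalℤ opened (+ m) ℤ.+ ℤSum.sum (λ b → evalℤ (joined b) (+ m))
    ≡⟨ cong (ℤ._+_ ((+ m ℤ.- + r) ℤ.* evalℤ opened (+ m))) (ℤSum.sum-cong-≗ old-colour) ⟩
  (+ m ℤ.- + r) ℤ.* evalℤ opened (+ m) ℤ.+ ℤSum.sum (λ b → + choices (g b))
    ≡⟨ sum-outside-image (λ a → + choices a) (evalℤ opened (+ m)) g inj new-colour ⟨
  ℤSum.sum (λ a → + choices a)
    ≡⟨ +-sum choices ⟨
  + sum choices ∎
  where
  open ≡-Reasoning
  opened = extensionPoly (tailG G) (openBlock G forb)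
  joined : Fin r → List ℤ
  joined b = if forb b fz then [] else extensionPoly (tailG G) (joinBlock G forb b)
  choices : Fin m → ℕ
  choices a = if allow fz a then listColourings (tailG G) (exclude G allow a) else 0
  ∧not : ∀ x y z → not x ∧ not (y ∧ z) ≡ not (x ∨ (y ∧ z))
  ∧not true  _ _ = refl
  ∧not false _ _ = refl
  g-does : ∀ b b′ → does (g b ≟ g b′) ≡ does (b ≟ b′)
  g-does b b′ with b ≟ b′
  ... | yes refl = dec-true (g b ≟ g b) refl
  ... | no  b≢b′ = dec-false (g b ≟ g b′) (b≢b′ ∘ inj)
  ∧false : ∀ x y → x ≡ true → x ∧ not (y ∧ false) ≡ true
  ∧false true true  _ = refl
  ∧false true false _ = refl
  old-colour : ∀ b → evalℤ (joined b) (+ m) ≡ + choices (g b)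
  old-colour b with forb b fz | allow fz (g b) | on fz b
  ... | true  | false | _ = refl
  ... | false | true  | _ = extensionPoly-counts (tailG G) (joinBlock G forb b) (exclude G allow (g b)) g inj
    (λ i b′ → trans (cong₂ (λ x y → x ∧ not (adj G fz (fs i) ∧ y)) (on (fs i) b′) (g-does b b′))
                    (∧not (forb b′ (fs i)) (adj G fz (fs i)) (does (b ≟ b′))))
    (λ i a avoid → trans (cong (λ y → allow (fs i) a ∧ not (adj G fz (fs i) ∧ y)) (dec-false (g b ≟ a) (avoid b)))
                         (∧false _ (adj G fz (fs i)) (off (fs i) a avoid)))
  new-colour : ∀ a → (∀ b → g b ≢ a) → + choices a ≡ evalℤ opened (+ m)
  new-colour a fresh rewrite off fz a fresh =
    sym (extensionPoly-counts (tailG G) (openBlock G forb) (exclude G allow a) g′ inj′ on′ off′)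
    where
    g′ : Fin (suc r) → Fin m
    g′ fz     = a
    g′ (fs b) = g b
    inj′ : Injective _≡_ _≡_ g′
    inj′ {fz}   {fz}   _ = refl
    inj′ {fz}   {fs b} e = contradiction (sym e) (fresh b)
    inj′ {fs b} {fz}   e = contradiction e (fresh b)
    inj′ {fs b} {fs c} e = cong fs (inj e)
    ∧true : ∀ x y → x ≡ true → x ∧ not (y ∧ true) ≡ not y
    ∧true true true  _ = refl
    ∧true true false _ = refl
    ∧false′ : ∀ x y → x ∧ not (y ∧ false) ≡ x
    ∧false′ true true  = refl
    ∧false′ true false = refl
    ∧false′ false _    = refl
    on′ : ∀ i b → exclude G allow a i (g′ b) ≡ not (openBlock G forb b i)
    on′ i fz     = trans (cong (λ y → allow (fs i) a ∧ not (adj G fz (fs i) ∧ y)) (dec-true (a ≟ a) refl))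
                         (∧true _ (adj G fz (fs i)) (off (fs i) a fresh))
    on′ i (fs b) = trans (cong (λ y → allow (fs i) (g b) ∧ not (adj G fz (fs i) ∧ y)) (dec-false (a ≟ g b) (fresh b ∘ sym)))
                         (trans (∧false′ _ (adj G fz (fs i))) (on (fs i) b))
    off′ : ∀ i c → (∀ b → g′ b ≢ c) → exclude G allow a i c ≡ true
    off′ i c avoid = trans (cong (λ y → allow (fs i) c ∧ not (adj G fz (fs i) ∧ y)) (dec-false (a ≟ c) (avoid fz)))
                           (∧false _ (adj G fz (fs i)) (off (fs i) c (avoid ∘ fs)))

chromaticPoly : Graph n → List ℤ
chromaticPoly G = extensionPoly {r = 0} G (λ ())

chromaticPoly-correct : (G : Graph n) → IsChromaticPoly G (chromaticPoly G)
chromaticPoly-correct G m =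
  trans (extensionPoly-counts G (λ ()) (λ _ _ → true) (λ ()) (λ { {()} }) (λ _ ()) (λ _ _ _ → refl))
        (cong +_ (sym (numColorings≡listColourings G m)))

-- Non-edges, and the joins still possible.

nonEdges : Graph n → ℕ
nonEdges {zero}  G = 0
nonEdges {suc n} G = size (λ j → not (adj G fz (fs j))) + nonEdges (tailG G)

-- The exponent in the upper bounds: the admissible pairs of a class and an unprocessed vertex,
-- together with the non-edges among unprocessed vertices. Without classes it is the number of
-- non-edges.
slack : Graph n → (Fin r → Fin n → Bool) → ℕ
slack G forb = sum (λ b → size (λ i → not (forb b i))) + nonEdges G

-- The non-neighbours of vertex 0 turn from non-edges into admissible pairs with the new class, so
-- only the pairs of vertex 0 with old classes are lost.
slack-openBlock : (G : Graph (suc n)) (forb : Fin r → Fin (suc n) → Bool) →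
  slack G forb ≡ slack (tailG G) (openBlock G forb) + size (λ b → not (forb b fz))
slack-openBlock G forb =
  trans (cong (λ s → s + nonEdges G) (∑-distrib-+ (λ b → ⟦ not (forb b fz) ⟧) (λ b → size (λ i → not (forb b (fs i))))))
        (arith (size (λ b → not (forb b fz))) _ (size (λ j → not (adj G fz (fs j)))) _)
  where
  arith : ∀ p s q e → p + s + (q + e) ≡ q + s + e + p
  arith = solve-∀

-- A join creates no new class and can only add forbidden vertices to the old ones.
slack-joinBlock : (G : Graph (suc n)) (forb : Fin r → Fin (suc n) → Bool) (b : Fin r) →
  slack (tailG G) (joinBlock G forb b) ≤ slack (tailG G) (openBlock G forb)
slack-joinBlock G forb b =
  +-monoˡ-≤ _ (≤-trans (sum-mono λ b′ → sum-mono λ i → fewer (forb b′ (fs i)) _) (m≤n+m _ _))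
  where
  fewer : ∀ x y → ⟦ not (x ∨ y) ⟧ ≤ ⟦ not x ⟧
  fewer true  _     = ≤-refl
  fewer false true  = z≤n
  fewer false false = ≤-refl

nonEdges+numEdges : (G : Graph n) → nonEdges G + numEdges G ≡ n C 2
nonEdges+numEdges {zero}  G = refl
nonEdges+numEdges {suc n} G = begin
  size (λ j → not (adj G fz (fs j))) + nonEdges (tailG G) + numEdges G
    ≡⟨ cong (_+_ (nonEdges G)) (numEdges-suc G) ⟩
  size (λ j → not (adj G fz (fs j))) + nonEdges (tailG G) + (size (λ j → adj G fz (fs j)) + numEdges (tailG G))
    ≡⟨ arith (size (λ j → not (adj G fz (fs j)))) _ (size (λ j → adj G fz (fs j))) _ ⟩
  size (λ j → not (adj G fz (fs j))) + size (λ j → adj G fz (fs j)) + (nonEdges (tailG G) + numEdges (tailG G))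
    ≡⟨ cong₂ _+_ (complement (λ j → adj G fz (fs j))) (nonEdges+numEdges (tailG G)) ⟩
  n + n C 2
    ≡⟨ suc-C-2 n ⟨
  suc n C 2 ∎
  where
  open ≡-Reasoning
  arith : ∀ a b c d → a + b + (c + d) ≡ a + c + (b + d)
  arith = solve-∀
  complement : ∀ {n} (p : Fin n → Bool) → size (not ∘ p) + size p ≡ n
  complement {zero}  p = refl
  complement {suc n} p with p fz
  ... | true  = trans (+-suc _ _) (cong suc (complement (p ∘ fs)))
  ... | false = cong suc (complement (p ∘ fs))

-- The number D for chromatic number k + 1 and n = k + 1 + j, with the index shifted by one. Raising
-- n by one adds n - 1 to D, and the recursion has the form that the induction in `tree-lower`
-- consumes.
gap : ℕ → ℕ → ℕ
gap k zero    = 0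
gap k (suc j) = gap k j + (k + j)

gap-closed : ∀ k j → gap k j + (suc k C 2 + j) ≡ (suc k + j) C 2
gap-closed k zero    = trans (+-identityʳ (suc k C 2)) (cong (_C 2) (sym (+-identityʳ (suc k))))
gap-closed k (suc j) = begin
  gap k j + (k + j) + (suc k C 2 + suc j)   ≡⟨ arith (gap k j) k j (suc k C 2) ⟩
  suc k + j + (gap k j + (suc k C 2 + j))   ≡⟨ cong (_+_ (suc k + j)) (gap-closed k j) ⟩
  suc k + j + (suc k + j) C 2               ≡⟨ suc-C-2 (suc k + j) ⟨
  suc (suc k + j) C 2                       ≡⟨ cong (_C 2) (+-suc (suc k) j) ⟨
  (suc k + suc j) C 2                       ∎
  where
  open ≡-Reasoning
  arith : ∀ g k j c → g + (k + j) + (c + suc j) ≡ suc k + j + (g + (c + j))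
  arith = solve-∀

-- Estimates in an ordered field, beginning with the integers in it.

module FieldBounds (F : OrderedField) where

  open OrderedField F renaming
    ( _+_ to infixl 6 _⊕_ ; _*_ to infixl 7 _⊗_ ; _-_ to infixl 6 _⊖_ ; -_ to infix 8 ⊝_
    ; _<_ to infix 4 _≺_ ; refl to ≈-refl ; sym to ≈-sym ; trans to ≈-trans
    ; +-assoc to ⊕-assoc ; +-comm to ⊕-comm ; +-identityˡ to ⊕-identityˡ ; +-identityʳ to ⊕-identityʳ
    ; +-cong to ⊕-cong ; +-congˡ to ⊕-congˡ ; +-congʳ to ⊕-congʳ ; -‿inverseʳ to ⊝-inverseʳ ; -‿cong to ⊝-cong
    ; *-assoc to ⊗-assoc ; *-comm to ⊗-comm ; *-identityˡ to ⊗-identityˡ ; *-identityʳ to ⊗-identityʳ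
    ; *-cong to ⊗-cong ; *-congˡ to ⊗-congˡ ; *-congʳ to ⊗-congʳ ; zeroˡ to ⊗-zeroˡ ; zeroʳ to ⊗-zeroʳ
    ; distribˡ to ⊗-distribˡ ; distribʳ to ⊗-distribʳ ; +-mono-< to ⊕-mono-≺ ; *-pos to ⊗-pos )
    using (Carrier; _≈_; 0#; 1#; isSTO; nontrivial; inverse; ring; commRing; reflexive)
  open IsStrictTotalOrder isSTO using (compare; isStrictPartialOrder) renaming (irrefl to ≺-irrefl)
  open ToNonStrict _≈_ _≺_ using () renaming (_≤_ to infix 4 _≼_)
  open RingProperties ring using (-‿distribˡ-*; -‿distribʳ-*; -‿involutive; -‿+-comm; -0#≈0#)

  strictPartialOrder : StrictPartialOrder _ _ _
  strictPartialOrder = record { isStrictPartialOrder = isStrictPartialOrder }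

  open OrderReasoning strictPartialOrder

  ι : ℕ → Carrier
  ι = fromℕ F

  ι-+ : ∀ m n → ι (m + n) ≈ ι m ⊕ ι n
  ι-+ zero    n = ≈-sym (⊕-identityˡ _)
  ι-+ (suc m) n = ≈-trans (⊕-congˡ (ι-+ m n)) (≈-sym (⊕-assoc 1# (ι m) (ι n)))

  ι-* : ∀ m n → ι (m * n) ≈ ι m ⊗ ι n
  ι-* zero    n = ≈-sym (⊗-zeroˡ _)
  ι-* (suc m) n = begin-equality
    ι (n + m * n)             ≈⟨ ι-+ n (m * n) ⟩
    ι n ⊕ ι (m * n)           ≈⟨ ⊕-cong (≈-sym (⊗-identityˡ _)) (ι-* m n) ⟩
    1# ⊗ ι n ⊕ ι m ⊗ ι n      ≈⟨ ⊗-distribʳ (ι n) 1# (ι m) ⟨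
    ι (suc m) ⊗ ι n           ∎

  fromℤ-neg : ∀ i → fromℤ F (ℤ.- i) ≈ ⊝ fromℤ F i
  fromℤ-neg (+ zero)  = ≈-sym -0#≈0#
  fromℤ-neg (+ suc m) = ≈-refl
  fromℤ-neg -[1+ m ]  = ≈-sym (-‿involutive _)

  -- Calculated by hand, since the ring solver used later is built on these homomorphism laws.
  fromℤ-⊖ : ∀ m n → fromℤ F (m ℤ.⊖ n) ≈ ι m ⊖ ι n
  fromℤ-⊖ m       zero    = ≈-sym (≈-trans (⊕-congˡ -0#≈0#) (⊕-identityʳ _))
  fromℤ-⊖ zero    (suc n) = ≈-sym (⊕-identityˡ _)
  fromℤ-⊖ (suc m) (suc n) = begin-equality
    fromℤ F (suc m ℤ.⊖ suc n)         ≡⟨ cong (fromℤ F) (ℤ.[1+m]⊖[1+n]≡m⊖n m n) ⟩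
    fromℤ F (m ℤ.⊖ n)                 ≈⟨ fromℤ-⊖ m n ⟩
    ι m ⊖ ι n                         ≈⟨ ⊕-identityˡ _ ⟨
    0# ⊕ (ι m ⊖ ι n)                  ≈⟨ ⊕-congʳ (⊝-inverseʳ 1#) ⟨
    (1# ⊖ 1#) ⊕ (ι m ⊖ ι n)           ≈⟨ ⊕-assoc _ _ _ ⟩
    1# ⊕ (⊝ 1# ⊕ (ι m ⊖ ι n))         ≈⟨ ⊕-congˡ (⊕-assoc _ _ _) ⟨
    1# ⊕ ((⊝ 1# ⊕ ι m) ⊖ ι n)         ≈⟨ ⊕-congˡ (⊕-congʳ (⊕-comm _ _)) ⟩
    1# ⊕ ((ι m ⊖ 1#) ⊖ ι n)           ≈⟨ ⊕-congˡ (⊕-assoc _ _ _) ⟩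
    1# ⊕ (ι m ⊕ (⊝ 1# ⊖ ι n))         ≈⟨ ⊕-assoc _ _ _ ⟨
    (1# ⊕ ι m) ⊕ (⊝ 1# ⊖ ι n)         ≈⟨ ⊕-congˡ (-‿+-comm 1# (ι n)) ⟩
    ι (suc m) ⊖ ι (suc n)             ∎

  fromℤ-+ : ∀ i j → fromℤ F (i ℤ.+ j) ≈ fromℤ F i ⊕ fromℤ F j
  fromℤ-+ (+ m)    (+ n)    = ι-+ m n
  fromℤ-+ (+ m)    -[1+ n ] = fromℤ-⊖ m (suc n)
  fromℤ-+ -[1+ m ] (+ n)    = ≈-trans (fromℤ-⊖ n (suc m)) (⊕-comm _ _)
  fromℤ-+ -[1+ m ] -[1+ n ] = begin-equality
    ⊝ ι (suc (suc (m + n)))           ≡⟨ cong (λ z → ⊝ ι (suc z)) (+-suc m n) ⟨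
    ⊝ ι (suc m + suc n)               ≈⟨ ⊝-cong (ι-+ (suc m) (suc n)) ⟩
    ⊝ (ι (suc m) ⊕ ι (suc n))         ≈⟨ -‿+-comm _ _ ⟨
    ⊝ ι (suc m) ⊖ ι (suc n)           ∎

  fromℤ-* : ∀ i j → fromℤ F (i ℤ.* j) ≈ fromℤ F i ⊗ fromℤ F j
  fromℤ-*-ι : ∀ m j → fromℤ F (+ m ℤ.* j) ≈ ι m ⊗ fromℤ F j
  fromℤ-*-ι m (+ n)    = ≈-trans (reflexive (cong (fromℤ F) (sym (ℤ.pos-* m n)))) (ι-* m n)
  fromℤ-*-ι m -[1+ n ] = begin-equality
    fromℤ F (+ m ℤ.* ℤ.- + suc n)     ≡⟨ cong (fromℤ F) (ℤ.neg-distribʳ-* (+ m) (+ suc n)) ⟨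
    fromℤ F (ℤ.- (+ m ℤ.* + suc n))   ≈⟨ fromℤ-neg (+ m ℤ.* + suc n) ⟩
    ⊝ fromℤ F (+ m ℤ.* + suc n)       ≈⟨ ⊝-cong (fromℤ-*-ι m (+ suc n)) ⟩
    ⊝ (ι m ⊗ ι (suc n))               ≈⟨ -‿distribʳ-* _ _ ⟩
    ι m ⊗ ⊝ ι (suc n)                 ∎
  fromℤ-* (+ m)    j = fromℤ-*-ι m j
  fromℤ-* -[1+ m ] j = begin-equality
    fromℤ F (ℤ.- + suc m ℤ.* j)       ≡⟨ cong (fromℤ F) (ℤ.neg-distribˡ-* (+ suc m) j) ⟨
    fromℤ F (ℤ.- (+ suc m ℤ.* j))     ≈⟨ fromℤ-neg (+ suc m ℤ.* j) ⟩
    ⊝ fromℤ F (+ suc m ℤ.* j)         ≈⟨ ⊝-cong (fromℤ-*-ι (suc m) j) ⟩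
    ⊝ (ι (suc m) ⊗ fromℤ F j)         ≈⟨ -‿distribˡ-* _ _ ⟩
    ⊝ ι (suc m) ⊗ fromℤ F j           ∎

  -- Agrees with fromℤ up to ≈, but sends 1 to 1# on the nose so that the solver's con (+ 1) matches 1#.
  coeff : ℤ → Carrier
  coeff (+ 1) = 1#
  coeff i     = fromℤ F i

  coeff≈fromℤ : ∀ i → coeff i ≈ fromℤ F i
  coeff≈fromℤ (+ 0)            = ≈-refl
  coeff≈fromℤ (+ 1)            = ≈-sym (⊕-identityʳ 1#)
  coeff≈fromℤ (+ suc (suc m))  = ≈-refl
  coeff≈fromℤ -[1+ m ]         = ≈-refl

  coeff-morphism : ℤ.+-*-rawRing -Raw-AlmostCommutative⟶ fromCommutativeRing commRing
  coeff-morphism = record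
    { ⟦_⟧    = coeff
    ; +-homo = λ i j → ≈-trans (coeff≈fromℤ (i ℤ.+ j)) (≈-trans (fromℤ-+ i j) (≈-sym (⊕-cong (coeff≈fromℤ i) (coeff≈fromℤ j))))
    ; *-homo = λ i j → ≈-trans (coeff≈fromℤ (i ℤ.* j)) (≈-trans (fromℤ-* i j) (≈-sym (⊗-cong (coeff≈fromℤ i) (coeff≈fromℤ j))))
    ; -‿homo = λ i → ≈-trans (coeff≈fromℤ (ℤ.- i)) (≈-trans (fromℤ-neg i) (⊝-cong (≈-sym (coeff≈fromℤ i))))
    ; 0-homo = ≈-refl
    ; 1-homo = ≈-refl
    }

  coeff-≟ : ∀ i j → Maybe (coeff i ≈ coeff j)
  coeff-≟ i j with i ℤ.≟ j
  ... | yes i≡j = just (reflexive (cong coeff i≡j))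
  ... | no  _   = nothing

  open RingSolver ℤ.+-*-rawRing (fromCommutativeRing commRing) coeff-morphism coeff-≟
    using (solve; _:=_; con; _:+_; _:*_; _:-_; :-_)

  private
    𝟙 : ∀ {v} → RingSolver.Polynomial ℤ.+-*-rawRing (fromCommutativeRing commRing) coeff-morphism coeff-≟ v
    𝟙 = con (+ 1)

  -- Order and arithmetic.

  ⊕-monoˡ : ∀ {a b} c → a ≼ b → a ⊕ c ≼ b ⊕ c
  ⊕-monoˡ c (inj₁ a≺b) = inj₁ (⊕-mono-≺ c a≺b)
  ⊕-monoˡ c (inj₂ a≈b) = inj₂ (⊕-congʳ a≈b)

  ⊕-mono : ∀ {a b c d} → a ≼ b → c ≼ d → a ⊕ c ≼ b ⊕ d
  ⊕-mono {a} {b} {c} {d} a≼b c≼d = begin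
    a ⊕ c   ≤⟨ ⊕-monoˡ c a≼b ⟩
    b ⊕ c   ≈⟨ ⊕-comm b c ⟩
    c ⊕ b   ≤⟨ ⊕-monoˡ b c≼d ⟩
    d ⊕ b   ≈⟨ ⊕-comm d b ⟩
    b ⊕ d   ∎

  ≺⇒0≺⊖ : ∀ {a b} → a ≺ b → 0# ≺ b ⊖ a
  ≺⇒0≺⊖ {a} {b} a≺b = begin-strict
    0#      ≈⟨ ⊝-inverseʳ a ⟨
    a ⊖ a   <⟨ ⊕-mono-≺ (⊝ a) a≺b ⟩
    b ⊖ a   ∎

  0≺⊖⇒≺ : ∀ {a b} → 0# ≺ b ⊖ a → a ≺ b
  0≺⊖⇒≺ {a} {b} h = begin-strict
    a             ≈⟨ ⊕-identityˡ a ⟨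
    0# ⊕ a        <⟨ ⊕-mono-≺ a h ⟩
    b ⊖ a ⊕ a     ≈⟨ solve 2 (λ a b → b :- a :+ a := b) ≈-refl a b ⟩
    b             ∎

  ⊗-monoˡ-≺ : ∀ {a b c} → 0# ≺ c → a ≺ b → c ⊗ a ≺ c ⊗ b
  ⊗-monoˡ-≺ {a} {b} {c} 0≺c a≺b = 0≺⊖⇒≺ (begin-strict
    0#                <⟨ ⊗-pos 0≺c (≺⇒0≺⊖ a≺b) ⟩
    c ⊗ (b ⊖ a)       ≈⟨ solve 3 (λ a b c → c :* (b :- a) := c :* b :- c :* a) ≈-refl a b c ⟩
    c ⊗ b ⊖ c ⊗ a     ∎)

  ⊗-monoˡ : ∀ {a b c} → 0# ≼ c → a ≼ b → c ⊗ a ≼ c ⊗ b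
  ⊗-monoˡ (inj₁ 0≺c) (inj₁ a≺b) = inj₁ (⊗-monoˡ-≺ 0≺c a≺b)
  ⊗-monoˡ (inj₂ 0≈c) (inj₁ a≺b) =
    inj₂ (≈-trans (⊗-congʳ (≈-sym 0≈c)) (≈-trans (⊗-zeroˡ _) (≈-trans (≈-sym (⊗-zeroˡ _)) (⊗-congʳ 0≈c))))
  ⊗-monoˡ 0≼c        (inj₂ a≈b) = inj₂ (⊗-congˡ a≈b)

  ⊗-monoʳ : ∀ {a b c} → 0# ≼ c → a ≼ b → a ⊗ c ≼ b ⊗ c
  ⊗-monoʳ {a} {b} {c} 0≼c a≼b = begin
    a ⊗ c   ≈⟨ ⊗-comm a c ⟩
    c ⊗ a   ≤⟨ ⊗-monoˡ 0≼c a≼b ⟩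
    c ⊗ b   ≈⟨ ⊗-comm c b ⟩
    b ⊗ c   ∎

  ⊗-nonneg : ∀ {a b} → 0# ≼ a → 0# ≼ b → 0# ≼ a ⊗ b
  ⊗-nonneg {a} {b} 0≼a 0≼b = begin
    0#       ≈⟨ ⊗-zeroʳ a ⟨
    a ⊗ 0#   ≤⟨ ⊗-monoˡ 0≼a 0≼b ⟩
    a ⊗ b    ∎

  ≺⇒⋡ : ∀ {a b} → a ≺ b → ¬ b ≼ a
  ≺⇒⋡ {a} {b} a≺b b≼a = ≺-irrefl ≈-refl (begin-strict
    a   <⟨ a≺b ⟩
    b   ≤⟨ b≼a ⟩
    a   ∎)

  ⋡⇒≺ : ∀ {a b} → ¬ b ≼ a → a ≺ b
  ⋡⇒≺ {a} {b} h with compare a b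
  ... | tri< a≺b _ _ = a≺b
  ... | tri≈ _ a≈b _ = contradiction (inj₂ (≈-sym a≈b)) h
  ... | tri> _ _ b≺a = contradiction (inj₁ b≺a) h

  ⊗-cancelˡ : ∀ {a b c} → 0# ≺ c → c ⊗ a ≼ c ⊗ b → a ≼ b
  ⊗-cancelˡ {a} {b} 0≺c h with compare a b
  ... | tri< a≺b _ _ = inj₁ a≺b
  ... | tri≈ _ a≈b _ = inj₂ a≈b
  ... | tri> _ _ b≺a = contradiction h (≺⇒⋡ (⊗-monoˡ-≺ 0≺c b≺a))

  -- If 1 were below 0, then 0 - 1 would be positive, and so would its square, which is 1.
  0≺1 : 0# ≺ 1#
  0≺1 with compare 0# 1#
  ... | tri< 0≺1 _ _ = 0≺1
  ... | tri≈ _ 0≈1 _ = contradiction 0≈1 nontrivial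
  ... | tri> _ _ 1≺0 = contradiction (inj₁ 1≺0) (≺⇒⋡ (begin-strict
    0#                            <⟨ ⊗-pos (≺⇒0≺⊖ 1≺0) (≺⇒0≺⊖ 1≺0) ⟩
    (0# ⊖ 1#) ⊗ (0# ⊖ 1#)         ≈⟨ solve 0 ((con (+ 0) :- 𝟙) :* (con (+ 0) :- 𝟙) := 𝟙) ≈-refl ⟩
    1#                            ∎))

  ≼-refl : ∀ {a} → a ≼ a
  ≼-refl = inj₂ ≈-refl

  ι-nonneg : ∀ m → 0# ≼ ι m
  ι-nonneg zero    = ≼-refl
  ι-nonneg (suc m) = begin
    0#          ≈⟨ ⊕-identityˡ 0# ⟨
    0# ⊕ 0#     ≤⟨ ⊕-mono (inj₁ 0≺1) (ι-nonneg m) ⟩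
    ι (suc m)   ∎

  ι-mono : ∀ {m n} → m ≤ n → ι m ≼ ι n
  ι-mono {n = n} z≤n = ι-nonneg n
  ι-mono (s≤s m≤n)   = ⊕-mono ≼-refl (ι-mono m≤n)

  ι1≈1 : ι 1 ≈ 1#
  ι1≈1 = ⊕-identityʳ 1#

  ⊖-antimono : ∀ {a b} c → a ≼ b → c ⊖ b ≼ c ⊖ a
  ⊖-antimono {a} {b} c a≼b = begin
    c ⊖ b                   ≈⟨ solve 3 (λ a b c → c :- b := a :+ (c :- a :- b)) ≈-refl a b c ⟩
    a ⊕ (c ⊖ a ⊖ b)         ≤⟨ ⊕-monoˡ _ a≼b ⟩
    b ⊕ (c ⊖ a ⊖ b)         ≈⟨ solve 3 (λ a b c → b :+ (c :- a :- b) := c :- a) ≈-refl a b c ⟩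
    c ⊖ a                   ∎

  -- Evaluation of integer polynomials in the field.

  evalF-addP : ∀ p q x → evalF F (addP p q) x ≈ evalF F p x ⊕ evalF F q x
  evalF-addP []      q       x = ≈-sym (⊕-identityˡ _)
  evalF-addP (a ∷ p) []      x = ≈-sym (⊕-identityʳ _)
  evalF-addP (a ∷ p) (b ∷ q) x = begin-equality
    fromℤ F (a ℤ.+ b) ⊕ x ⊗ evalF F (addP p q) x
      ≈⟨ ⊕-cong (fromℤ-+ a b) (⊗-congˡ (evalF-addP p q x)) ⟩
    fromℤ F a ⊕ fromℤ F b ⊕ x ⊗ (evalF F p x ⊕ evalF F q x)
      ≈⟨ solve 5 (λ a b x u v → a :+ b :+ x :* (u :+ v) := a :+ x :* u :+ (b :+ x :* v)) ≈-refl _ _ _ _ _ ⟩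
    evalF F (a ∷ p) x ⊕ evalF F (b ∷ q) x ∎

  evalF-scaleP : ∀ c p x → evalF F (scaleP c p) x ≈ fromℤ F c ⊗ evalF F p x
  evalF-scaleP c []      x = ≈-sym (⊗-zeroʳ _)
  evalF-scaleP c (a ∷ p) x = begin-equality
    fromℤ F (c ℤ.* a) ⊕ x ⊗ evalF F (scaleP c p) x
      ≈⟨ ⊕-cong (fromℤ-* c a) (⊗-congˡ (evalF-scaleP c p x)) ⟩
    fromℤ F c ⊗ fromℤ F a ⊕ x ⊗ (fromℤ F c ⊗ evalF F p x)
      ≈⟨ solve 4 (λ c a x u → c :* a :+ x :* (c :* u) := c :* (a :+ x :* u)) ≈-refl _ _ _ _ ⟩
    fromℤ F c ⊗ evalF F (a ∷ p) x ∎

  evalF-timesX- : ∀ r p x → evalF F (timesX- r p) x ≈ (x ⊖ ι r) ⊗ evalF F p x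
  evalF-timesX- r p x = begin-equality
    evalF F (timesX- r p) x
      ≈⟨ evalF-addP (+ 0 ∷ p) (scaleP (ℤ.- + r) p) x ⟩
    0# ⊕ x ⊗ evalF F p x ⊕ evalF F (scaleP (ℤ.- + r) p) x
      ≈⟨ ⊕-cong (⊕-identityˡ _) (≈-trans (evalF-scaleP (ℤ.- + r) p x) (⊗-congʳ (fromℤ-neg (+ r)))) ⟩
    x ⊗ evalF F p x ⊕ ⊝ ι r ⊗ evalF F p x
      ≈⟨ ⊗-distribʳ _ _ _ ⟨
    (x ⊖ ι r) ⊗ evalF F p x ∎

  evalF-zero : ∀ {p} → All (_≡ + 0) p → ∀ x → evalF F p x ≈ 0#
  evalF-zero []         x = ≈-refl
  evalF-zero (refl ∷ z) x = ≈-trans (⊕-identityˡ _) (≈-trans (⊗-congˡ (evalF-zero z x)) (⊗-zeroʳ x))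

  -- Agreement on ℕ passes to the field through the coefficients: those of the difference are all
  -- zero by `vanishing⇒zero`, so it vanishes at every x.
  evalF-unique : ∀ p q → (∀ m → evalℤ p (+ m) ≡ evalℤ q (+ m)) → ∀ x → evalF F p x ≈ evalF F q x
  evalF-unique p q same x = begin-equality
    evalF F p x
      ≈⟨ solve 2 (λ u v → u := u :+ (:- 𝟙) :* v :+ v) ≈-refl (evalF F p x) (evalF F q x) ⟩
    evalF F p x ⊕ ⊝ 1# ⊗ evalF F q x ⊕ evalF F q x
      ≈⟨ ⊕-congʳ (⊕-congˡ (⊗-congʳ (⊝-cong ι1≈1))) ⟨
    evalF F p x ⊕ fromℤ F ℤ.-1ℤ ⊗ evalF F q x ⊕ evalF F q x
      ≈⟨ ⊕-congʳ (⊕-congˡ (evalF-scaleP ℤ.-1ℤ q x)) ⟨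
    evalF F p x ⊕ evalF F (scaleP ℤ.-1ℤ q) x ⊕ evalF F q x
      ≈⟨ ⊕-congʳ (evalF-addP p (scaleP ℤ.-1ℤ q) x) ⟨
    evalF F (addP p (scaleP ℤ.-1ℤ q)) x ⊕ evalF F q x
      ≈⟨ ⊕-congʳ (evalF-zero (vanishing⇒zero (addP p (scaleP ℤ.-1ℤ q)) difference) x) ⟩
    0# ⊕ evalF F q x
      ≈⟨ ⊕-identityˡ _ ⟩
    evalF F q x ∎
    where
    difference : ∀ m → evalℤ (addP p (scaleP ℤ.-1ℤ q)) (+ suc m) ≡ + 0
    difference m = trans (evalℤ-addP p (scaleP ℤ.-1ℤ q) (+ suc m))
      (trans (cong₂ ℤ._+_ (same (suc m)) (trans (evalℤ-scaleP ℤ.-1ℤ q (+ suc m)) (ℤ.-1*i≡-i _)))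
             (ℤ.+-inverseʳ (evalℤ q (+ suc m))))

  sumP-bound : (c M x : Carrier) (skip : Fin r → Bool) (f : Fin r → List ℤ) →
    (∀ b → c ⊗ evalF F (f b) x ≼ M) →
    c ⊗ evalF F (sumP (λ b → if skip b then [] else f b)) x ≼ ι (size (not ∘ skip)) ⊗ M
  sumP-bound {zero}  c M x skip f h = inj₂ (≈-trans (⊗-zeroʳ c) (≈-sym (⊗-zeroˡ M)))
  sumP-bound {suc r} c M x skip f h with skip fz
  ... | true  = sumP-bound c M x (skip ∘ fs) (f ∘ fs) (h ∘ fs)
  ... | false = begin
    c ⊗ evalF F (addP (f fz) rest) x                   ≈⟨ ⊗-congˡ (evalF-addP (f fz) rest x) ⟩
    c ⊗ (evalF F (f fz) x ⊕ evalF F rest x)            ≈⟨ ⊗-distribˡ c _ _ ⟩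
    c ⊗ evalF F (f fz) x ⊕ c ⊗ evalF F rest x          ≤⟨ ⊕-mono (h fz) (sumP-bound c M x (skip ∘ fs) (f ∘ fs) (h ∘ fs)) ⟩
    M ⊕ ι (size (not ∘ skip ∘ fs)) ⊗ M                 ≈⟨ solve 2 (λ M s → M :+ s :* M := (𝟙 :+ s) :* M) ≈-refl M _ ⟩
    (1# ⊕ ι (size (not ∘ skip ∘ fs))) ⊗ M              ∎
    where rest = sumP (λ b → if skip (fs b) then [] else f (fs b))

  -- Powers of 1 + t.

  pow-+ : ∀ w a b → pow F w (a + b) ≈ pow F w b ⊗ pow F w a
  pow-+ w zero    b = ≈-sym (⊗-identityʳ _)
  pow-+ w (suc a) b = ≈-trans (⊗-congʳ (pow-+ w a b)) (⊗-assoc _ _ _)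

  bernoulli : ∀ {t} → 0# ≼ t → ∀ p → 1# ⊕ ι p ⊗ t ≼ pow F (1# ⊕ t) p
  bernoulli {t} 0≼t zero    = inj₂ (≈-trans (⊕-congˡ (⊗-zeroˡ t)) (⊕-identityʳ 1#))
  bernoulli {t} 0≼t (suc p) = begin
    1# ⊕ (1# ⊕ ι p) ⊗ t                   ≈⟨ ⊕-identityʳ _ ⟨
    1# ⊕ (1# ⊕ ι p) ⊗ t ⊕ 0#              ≤⟨ ⊕-mono ≼-refl (⊗-nonneg (⊗-nonneg (ι-nonneg p) 0≼t) 0≼t) ⟩
    1# ⊕ (1# ⊕ ι p) ⊗ t ⊕ ι p ⊗ t ⊗ t     ≈⟨ solve 2 (λ p t → 𝟙 :+ (𝟙 :+ p) :* t :+ p :* t :* t := (𝟙 :+ p :* t) :* (𝟙 :+ t)) ≈-refl (ι p) t ⟩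
    (1# ⊕ ι p ⊗ t) ⊗ (1# ⊕ t)             ≤⟨ ⊗-monoʳ 0≼1+t (bernoulli 0≼t p) ⟩
    pow F (1# ⊕ t) p ⊗ (1# ⊕ t)           ∎
    where
    0≼1+t : 0# ≼ 1# ⊕ t
    0≼1+t = begin
      0#        ≈⟨ ⊕-identityˡ 0# ⟨
      0# ⊕ 0#   ≤⟨ ⊕-mono (inj₁ 0≺1) 0≼t ⟩
      1# ⊕ t    ∎

  1≼pow : ∀ {t} → 0# ≼ t → ∀ d → 1# ≼ pow F (1# ⊕ t) d
  1≼pow {t} 0≼t d = begin
    1#                  ≈⟨ ⊕-identityʳ 1# ⟨
    1# ⊕ 0#             ≤⟨ ⊕-mono ≼-refl (⊗-nonneg (ι-nonneg d) 0≼t) ⟩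
    1# ⊕ ι d ⊗ t        ≤⟨ bernoulli 0≼t d ⟩
    pow F (1# ⊕ t) d    ∎

  pow-nonneg : ∀ {t} → 0# ≼ t → ∀ d → 0# ≼ pow F (1# ⊕ t) d
  pow-nonneg {t} 0≼t d = begin
    0#                 <⟨ 0≺1 ⟩
    1#                 ≤⟨ 1≼pow 0≼t d ⟩
    pow F (1# ⊕ t) d   ∎

  pow-mono : ∀ {t d e} → 0# ≼ t → d ≤ e → pow F (1# ⊕ t) d ≼ pow F (1# ⊕ t) e
  pow-mono {t} {d} {e} 0≼t d≤e = begin
    pow F (1# ⊕ t) d                                ≈⟨ ⊗-identityʳ _ ⟨
    pow F (1# ⊕ t) d ⊗ 1#                           ≤⟨ ⊗-monoˡ (pow-nonneg 0≼t d) (1≼pow 0≼t (e ∸ d)) ⟩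
    pow F (1# ⊕ t) d ⊗ pow F (1# ⊕ t) (e ∸ d)       ≈⟨ pow-+ (1# ⊕ t) (e ∸ d) d ⟨
    pow F (1# ⊕ t) (e ∸ d + d)                      ≡⟨ cong (pow F (1# ⊕ t)) (m∸n+n≡m d≤e) ⟩
    pow F (1# ⊕ t) e                                ∎

  -- A division-free form of (1 + t)^e ≤ 1 / (1 - e t). In the induction step (1 + t)(1 - (e + 1) t)
  -- falls short of 1 - e t by (e + 1) t².
  reverse-bernoulli : ∀ {t} → 0# ≼ t → ∀ e → pow F (1# ⊕ t) e ⊗ (1# ⊖ ι e ⊗ t) ≼ 1#
  reverse-bernoulli {t} 0≼t zero    = inj₂ (solve 1 (λ t → 𝟙 :* (𝟙 :- con (+ 0) :* t) := 𝟙) ≈-refl t)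
  reverse-bernoulli {t} 0≼t (suc e) = begin
    W ⊗ (1# ⊕ t) ⊗ (1# ⊖ (1# ⊕ ι e) ⊗ t)
      ≈⟨ solve 3 (λ W s t → W :* (𝟙 :+ t) :* (𝟙 :- (𝟙 :+ s) :* t) :=
                            W :* (𝟙 :- s :* t :- (𝟙 :+ s) :* t :* t)) ≈-refl W (ι e) t ⟩
    W ⊗ (1# ⊖ ι e ⊗ t ⊖ (1# ⊕ ι e) ⊗ t ⊗ t)
      ≤⟨ ⊗-monoˡ (pow-nonneg 0≼t e) (⊖-antimono _ (⊗-nonneg (⊗-nonneg (ι-nonneg (suc e)) 0≼t) 0≼t)) ⟩
    W ⊗ (1# ⊖ ι e ⊗ t ⊖ 0#)
      ≈⟨ solve 3 (λ W s t → W :* (𝟙 :- s :* t :- con (+ 0)) := W :* (𝟙 :- s :* t)) ≈-refl W (ι e) t ⟩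
    W ⊗ (1# ⊖ ι e ⊗ t)
      ≤⟨ reverse-bernoulli 0≼t e ⟩
    1# ∎
    where W = pow F (1# ⊕ t) e

  inverse-pos : ∀ {a b} → 0# ≺ a → a ⊗ b ≈ 1# → 0# ≺ b
  inverse-pos {a} {b} 0≺a ab≈1 = ⋡⇒≺ λ b≼0 → ≺⇒⋡ 0≺1 (begin
    1#       ≈⟨ ab≈1 ⟨
    a ⊗ b    ≤⟨ ⊗-monoˡ (inj₁ 0≺a) b≼0 ⟩
    a ⊗ 0#   ≈⟨ ⊗-zeroʳ a ⟩
    0#       ∎)

  -- If the claim failed, multiplying y + e + 1 ≤ y (1 + t)^e by 1 - e t > 0 and applying
  -- `reverse-bernoulli` would give (y + e + 1)(1 - e t) ≤ y. With y t = 1 this reads 1 ≤ e (e + 1)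
  -- t, whereas e (e + 1) < y makes that product less than 1.
  pow-upper : ∀ {y t} → 0# ≺ y → y ⊗ t ≈ 1# → ∀ e → ι (suc e * e) ≺ y →
    y ⊗ pow F (1# ⊕ t) e ≺ y ⊕ ι (suc e)
  pow-upper {y} {t} 0≺y yt≈1 e e[e+1]≺y = ⋡⇒≺ λ h → ≺⇒⋡ small (begin
    1#
      ≈⟨ solve 2 (λ y s → 𝟙 := 𝟙 :+ (y :- y)) ≈-refl y (ι e) ⟩
    1# ⊕ (y ⊖ y)
      ≈⟨ solve 3 (λ y s t → 𝟙 :+ (y :- y) := (y :+ (𝟙 :+ s) :- s :- (𝟙 :+ s) :* s :* t) :+ ((𝟙 :+ s) :* s :* t :- y)) ≈-refl y (ι e) t ⟩
    (y ⊕ (1# ⊕ ι e) ⊖ ι e ⊖ (1# ⊕ ι e) ⊗ ι e ⊗ t) ⊕ ((1# ⊕ ι e) ⊗ ι e ⊗ t ⊖ y)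
      ≈⟨ ⊕-congʳ (⊕-congʳ (⊕-congˡ (⊝-cong (≈-trans (≈-sym (⊗-identityʳ _)) (⊗-congˡ (≈-sym yt≈1)))))) ⟩
    (y ⊕ (1# ⊕ ι e) ⊖ ι e ⊗ (y ⊗ t) ⊖ (1# ⊕ ι e) ⊗ ι e ⊗ t) ⊕ ((1# ⊕ ι e) ⊗ ι e ⊗ t ⊖ y)
      ≈⟨ solve 3 (λ y s t → (y :+ (𝟙 :+ s) :- s :* (y :* t) :- (𝟙 :+ s) :* s :* t) :+ ((𝟙 :+ s) :* s :* t :- y) :=
                            (y :+ (𝟙 :+ s)) :* (𝟙 :- s :* t) :+ ((𝟙 :+ s) :* s :* t :- y)) ≈-refl y (ι e) t ⟩
    (y ⊕ ι (suc e)) ⊗ (1# ⊖ ι e ⊗ t) ⊕ ((1# ⊕ ι e) ⊗ ι e ⊗ t ⊖ y)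
      ≤⟨ ⊕-monoˡ _ (⊗-monoʳ 0≼1-et h) ⟩
    y ⊗ W ⊗ (1# ⊖ ι e ⊗ t) ⊕ ((1# ⊕ ι e) ⊗ ι e ⊗ t ⊖ y)
      ≈⟨ ⊕-congʳ (⊗-assoc _ _ _) ⟩
    y ⊗ (W ⊗ (1# ⊖ ι e ⊗ t)) ⊕ ((1# ⊕ ι e) ⊗ ι e ⊗ t ⊖ y)
      ≤⟨ ⊕-monoˡ _ (⊗-monoˡ (inj₁ 0≺y) (reverse-bernoulli 0≼t e)) ⟩
    y ⊗ 1# ⊕ ((1# ⊕ ι e) ⊗ ι e ⊗ t ⊖ y)
      ≈⟨ solve 3 (λ y s t → y :* 𝟙 :+ ((𝟙 :+ s) :* s :* t :- y) := t :* ((𝟙 :+ s) :* s)) ≈-refl y (ι e) t ⟩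
    t ⊗ ((1# ⊕ ι e) ⊗ ι e) ∎)
    where
    W = pow F (1# ⊕ t) e
    0≺t : 0# ≺ t
    0≺t = inverse-pos 0≺y yt≈1
    0≼t : 0# ≼ t
    0≼t = inj₁ 0≺t
    small : t ⊗ ((1# ⊕ ι e) ⊗ ι e) ≺ 1#
    small = begin-strict
      t ⊗ (ι (suc e) ⊗ ι e)   ≈⟨ ⊗-congˡ (ι-* (suc e) e) ⟨
      t ⊗ ι (suc e * e)       <⟨ ⊗-monoˡ-≺ 0≺t e[e+1]≺y ⟩
      t ⊗ y                   ≈⟨ ⊗-comm t y ⟩
      y ⊗ t                   ≈⟨ yt≈1 ⟩
      1#                      ∎
    0≼1-et : 0# ≼ 1# ⊖ ι e ⊗ t
    0≼1-et = inj₁ (≺⇒0≺⊖ (begin-strict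
      ι e ⊗ t                 ≈⟨ ⊗-comm (ι e) t ⟩
      t ⊗ ι e                 ≤⟨ ⊗-monoˡ 0≼t (ι-mono (m≤m+n e (e * e))) ⟩
      t ⊗ ι (suc e * e)       ≈⟨ ⊗-congˡ (ι-* (suc e) e) ⟩
      t ⊗ (ι (suc e) ⊗ ι e)   <⟨ small ⟩
      1#                      ∎))

  divide-≺ : ∀ {a b c} → 0# ≺ a → b ≺ a ⊗ c → Σ Carrier λ a⁻¹ → a ⊗ a⁻¹ ≈ 1# × a⁻¹ ⊗ b ≺ c
  divide-≺ {a} {b} {c} 0≺a b≺ac with inverse a (λ a≈0 → ≺-irrefl (≈-sym a≈0) 0≺a)
  ... | a⁻¹ , aa⁻¹≈1 = a⁻¹ , aa⁻¹≈1 , (begin-strict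
    a⁻¹ ⊗ b           <⟨ ⊗-monoˡ-≺ (inverse-pos 0≺a aa⁻¹≈1) b≺ac ⟩
    a⁻¹ ⊗ (a ⊗ c)     ≈⟨ solve 3 (λ i a c → i :* (a :* c) := a :* i :* c) ≈-refl a⁻¹ a c ⟩
    a ⊗ a⁻¹ ⊗ c       ≈⟨ ⊗-congʳ aa⁻¹≈1 ⟩
    1# ⊗ c            ≈⟨ ⊗-identityˡ c ⟩
    c                 ∎)

  ≺-respˡ : ∀ {a b c} → a ≈ b → b ≺ c → a ≺ c
  ≺-respˡ {a} {b} {c} a≈b b≺c = begin-strict
    a   ≈⟨ a≈b ⟩
    b   <⟨ b≺c ⟩
    c   ∎

  -- Upper bounds for the colouring polynomial.

  module _ (x : Carrier) where

    ⟨x⟩_ : ℕ → Carrier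
    ⟨x⟩_ = falling F x

    falling-pos : ∀ j → (∀ i → i < j → 0# ≺ x ⊖ ι i) → 0# ≺ ⟨x⟩ j
    falling-pos zero    pos = 0≺1
    falling-pos (suc j) pos = ⊗-pos (falling-pos j λ i i<j → pos i (m≤n⇒m≤1+n i<j)) (pos j ≤-refl)

    value : Graph n → (Fin r → Fin n → Bool) → Carrier
    value G forb = evalF F (extensionPoly G forb) x

    joined-value : Graph (suc n) → (Fin r → Fin (suc n) → Bool) → Carrier
    joined-value G forb = evalF F (sumP λ b → if forb b fz then [] else extensionPoly (tailG G) (joinBlock G forb b)) x

    -- Scaling by the falling factorial lets it absorb the factor x - r that counts the colours of a
    -- new class.
    value-suc : (G : Graph (suc n)) (forb : Fin r → Fin (suc n) → Bool) →
      ⟨x⟩ r ⊗ value G forb ≈ ⟨x⟩ (suc r) ⊗ value (tailG G) (openBlock G forb) ⊕ ⟨x⟩ r ⊗ joined-value G forb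
    value-suc {r = r} G forb = begin-equality
      ⟨x⟩ r ⊗ value G forb
        ≈⟨ ⊗-congˡ (≈-trans (evalF-addP (timesX- r opened) _ x) (⊕-congʳ (evalF-timesX- r opened x))) ⟩
      ⟨x⟩ r ⊗ ((x ⊖ ι r) ⊗ evalF F opened x ⊕ joined-value G forb)
        ≈⟨ solve 4 (λ f z o s → f :* (z :* o :+ s) := f :* z :* o :+ f :* s) ≈-refl _ _ _ _ ⟩
      ⟨x⟩ (suc r) ⊗ evalF F opened x ⊕ ⟨x⟩ r ⊗ joined-value G forb ∎
      where opened = extensionPoly (tailG G) (openBlock G forb)

    value-zero : (G : Graph 0) (forb : Fin r → Fin 0 → Bool) → ⟨x⟩ r ⊗ value G forb ≈ ⟨x⟩ (r + 0)
    value-zero {r = r} G forb = begin-equality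
      ⟨x⟩ r ⊗ (ι 1 ⊕ x ⊗ 0#)   ≈⟨ ⊗-congˡ (⊕-cong ι1≈1 (⊗-zeroʳ x)) ⟩
      ⟨x⟩ r ⊗ (1# ⊕ 0#)        ≈⟨ ⊗-congˡ (⊕-identityʳ 1#) ⟩
      ⟨x⟩ r ⊗ 1#               ≈⟨ ⊗-identityʳ _ ⟩
      ⟨x⟩ r                    ≡⟨ cong ⟨x⟩_ (+-identityʳ r) ⟨
      ⟨x⟩ (r + 0)              ∎

    -- By `slack-joinBlock` the slack after opening serves as a common exponent for all joins, so
    -- their sum is at most their number times one bound.
    joined-value-bound : ∀ {t} → 0# ≼ t → 0# ≼ ⟨x⟩ (r + n) →
      (G : Graph (suc n)) (forb : Fin r → Fin (suc n) → Bool) →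
      (∀ b → ⟨x⟩ r ⊗ value (tailG G) (joinBlock G forb b) ≼
             ⟨x⟩ (r + n) ⊗ pow F (1# ⊕ t) (slack (tailG G) (joinBlock G forb b))) →
      ⟨x⟩ r ⊗ joined-value G forb ≼
      ι (size (λ b → not (forb b fz))) ⊗ (⟨x⟩ (r + n) ⊗ pow F (1# ⊕ t) (slack (tailG G) (openBlock G forb)))
    joined-value-bound {r} {n} {t} 0≼t 0≼B G forb each =
      sumP-bound (⟨x⟩ r) _ x (λ b → forb b fz) (λ b → extensionPoly (tailG G) (joinBlock G forb b)) λ b → begin
        ⟨x⟩ r ⊗ value (tailG G) (joinBlock G forb b)
          ≤⟨ each b ⟩
        ⟨x⟩ (r + n) ⊗ pow F (1# ⊕ t) (slack (tailG G) (joinBlock G forb b))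
          ≤⟨ ⊗-monoˡ 0≼B (pow-mono 0≼t (slack-joinBlock G forb b)) ⟩
        ⟨x⟩ (r + n) ⊗ pow F (1# ⊕ t) (slack (tailG G) (openBlock G forb)) ∎

    -- The p possible joins of vertex 0 use up p units of slack, and by Bernoulli (1 + t)^p covers
    -- the factor 1 + p t.
    pow-slack : ∀ {t} → 0# ≼ t → (G : Graph (suc n)) (forb : Fin r → Fin (suc n) → Bool) →
      pow F (1# ⊕ t) (slack (tailG G) (openBlock G forb)) ⊗ (1# ⊕ ι (size (λ b → not (forb b fz))) ⊗ t) ≼
      pow F (1# ⊕ t) (slack G forb)
    pow-slack {t = t} 0≼t G forb = begin
      pow F (1# ⊕ t) d ⊗ (1# ⊕ ι p ⊗ t)        ≤⟨ ⊗-monoˡ (pow-nonneg 0≼t d) (bernoulli 0≼t p) ⟩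
      pow F (1# ⊕ t) d ⊗ pow F (1# ⊕ t) p      ≈⟨ pow-+ (1# ⊕ t) p d ⟨
      pow F (1# ⊕ t) (p + d)                   ≡⟨ cong (pow F (1# ⊕ t)) (trans (+-comm p d) (sym (slack-openBlock G forb))) ⟩
      pow F (1# ⊕ t) (slack G forb)            ∎
      where
      d = slack (tailG G) (openBlock G forb)
      p = size (λ b → not (forb b fz))

    -- Opening a class contributes at most `A` `W`, the joins at most p `B` `W`. A join lacks the
    -- factor x - (r + n) of `A`, which is at least u = 1/t, so `B` ≤ t `A` and the total is at most
    -- `A` `W` (1 + p t).
    value-bound : ∀ {u t} → 0# ≺ u → u ⊗ t ≈ 1# → (G : Graph n) (forb : Fin r → Fin n → Bool) →
      (∀ j → j < r + n → u ≼ x ⊖ ι j) →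
      ⟨x⟩ r ⊗ value G forb ≼ ⟨x⟩ (r + n) ⊗ pow F (1# ⊕ t) (slack G forb)
    value-bound {zero} {r} {u} {t} 0≺u ut≈1 G forb far = begin
      ⟨x⟩ r ⊗ value G forb                             ≈⟨ value-zero G forb ⟩
      ⟨x⟩ (r + 0)                                      ≈⟨ ⊗-identityʳ _ ⟨
      ⟨x⟩ (r + 0) ⊗ 1#                                 ≤⟨ ⊗-monoˡ 0≼A (1≼pow (inj₁ (inverse-pos 0≺u ut≈1)) (slack G forb)) ⟩
      ⟨x⟩ (r + 0) ⊗ pow F (1# ⊕ t) (slack G forb)      ∎
      where
      0≼A : 0# ≼ ⟨x⟩ (r + 0)
      0≼A = inj₁ (falling-pos (r + 0) λ i i< → begin-strict
        0#       <⟨ 0≺u ⟩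
        u        ≤⟨ far i i< ⟩
        x ⊖ ι i  ∎)
    value-bound {suc n} {r} {u} {t} 0≺u ut≈1 G forb far = begin
      ⟨x⟩ r ⊗ value G forb
        ≈⟨ value-suc G forb ⟩
      ⟨x⟩ (suc r) ⊗ value (tailG G) (openBlock G forb) ⊕ ⟨x⟩ r ⊗ joined-value G forb
        ≤⟨ ⊕-mono (value-bound 0≺u ut≈1 (tailG G) (openBlock G forb) far′)
                  (joined-value-bound 0≼t 0≼B G forb λ b →
                     value-bound 0≺u ut≈1 (tailG G) (joinBlock G forb b) λ j j< → far′ j (m≤n⇒m≤1+n j<)) ⟩
      A ⊗ W ⊕ ι p ⊗ (B ⊗ W)
        ≤⟨ ⊕-mono ≼-refl (⊗-monoˡ (ι-nonneg p) (⊗-monoʳ (pow-nonneg 0≼t d) B≼tA)) ⟩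
      A ⊗ W ⊕ ι p ⊗ (t ⊗ A ⊗ W)
        ≈⟨ solve 4 (λ A W p t → A :* W :+ p :* (t :* A :* W) := A :* (W :* (𝟙 :+ p :* t))) ≈-refl A W (ι p) t ⟩
      A ⊗ (W ⊗ (1# ⊕ ι p ⊗ t))
        ≤⟨ ⊗-monoˡ 0≼A (pow-slack 0≼t G forb) ⟩
      A ⊗ pow F (1# ⊕ t) (slack G forb)
        ≡⟨ cong (λ z → ⟨x⟩ z ⊗ pow F (1# ⊕ t) (slack G forb)) (+-suc r n) ⟨
      ⟨x⟩ (r + suc n) ⊗ pow F (1# ⊕ t) (slack G forb) ∎
      where
      d = slack (tailG G) (openBlock G forb)
      p = size (λ b → not (forb b fz))
      A = ⟨x⟩ (suc (r + n))
      B = ⟨x⟩ (r + n)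
      W = pow F (1# ⊕ t) d
      far′ : ∀ j → j < suc (r + n) → u ≼ x ⊖ ι j
      far′ j j< = far j (subst (j <_) (sym (+-suc r n)) j<)
      pos : ∀ i → i < suc (r + n) → 0# ≺ x ⊖ ι i
      pos i i< = begin-strict
        0#       <⟨ 0≺u ⟩
        u        ≤⟨ far′ i i< ⟩
        x ⊖ ι i  ∎
      0≼t : 0# ≼ t
      0≼t = inj₁ (inverse-pos 0≺u ut≈1)
      0≼A : 0# ≼ A
      0≼A = inj₁ (falling-pos (suc (r + n)) pos)
      0≼B : 0# ≼ B
      0≼B = inj₁ (falling-pos (r + n) λ i i< → pos i (m≤n⇒m≤1+n i<))
      B≼tA : B ≼ t ⊗ A
      B≼tA = begin
        B                               ≈⟨ ⊗-identityʳ B ⟨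
        B ⊗ 1#                          ≈⟨ ⊗-congˡ ut≈1 ⟨
        B ⊗ (u ⊗ t)                     ≤⟨ ⊗-monoˡ 0≼B (⊗-monoʳ 0≼t (far′ (r + n) ≤-refl)) ⟩
        B ⊗ ((x ⊖ ι (r + n)) ⊗ t)       ≈⟨ solve 3 (λ B z t → B :* (z :* t) := t :* (B :* z)) ≈-refl B _ t ⟩
        t ⊗ A                           ∎

    -- The setting of the sharp bound: y stands for x - (N - 2), so the last of the N factors is y -
    -- 1 and the others are at least y.
    sharp-pos : ∀ {y} N → 0# ≺ y → 0# ≺ y ⊖ 1# →
      (∀ j → suc j ≡ N → y ⊖ 1# ≈ x ⊖ ι j) → (∀ j → suc j < N → y ≼ x ⊖ ι j) →
      ∀ i → i < N → 0# ≺ x ⊖ ι i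
    sharp-pos {y} N 0≺y 0≺y-1 last far i i<N with m≤n⇒m<n∨m≡n i<N
    ... | inj₁ i+1<N = begin-strict
      0#        <⟨ 0≺y ⟩
      y         ≤⟨ far i i+1<N ⟩
      x ⊖ ι i   ∎
    ... | inj₂ i+1≡N = begin-strict
      0#        <⟨ 0≺y-1 ⟩
      y ⊖ 1#    ≈⟨ last i i+1≡N ⟩
      x ⊖ ι i   ∎

    -- A joined term has one vertex fewer, which leaves room for the cruder value-bound there.
    value-sharp-bound : ∀ {y t} → 0# ≺ y → y ⊗ t ≈ 1# → 0# ≺ y ⊖ 1# →
      (G : Graph n) (forb : Fin r → Fin n → Bool) →
      (∀ j → suc j ≡ r + n → y ⊖ 1# ≈ x ⊖ ι j) → (∀ j → suc j < r + n → y ≼ x ⊖ ι j) →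
      (y ⊖ 1#) ⊗ (⟨x⟩ r ⊗ value G forb) ≼ ⟨x⟩ (r + n) ⊗ (y ⊗ pow F (1# ⊕ t) (slack G forb) ⊖ 1#)
    value-sharp-bound {zero} {r} {y} {t} 0≺y yt≈1 0≺y-1 G forb last far = begin
      (y ⊖ 1#) ⊗ (⟨x⟩ r ⊗ value G forb)
        ≈⟨ ⊗-congˡ (value-zero G forb) ⟩
      (y ⊖ 1#) ⊗ A
        ≈⟨ solve 2 (λ y A → (y :- 𝟙) :* A := A :* (y :* 𝟙 :- 𝟙)) ≈-refl y A ⟩
      A ⊗ (y ⊗ 1# ⊖ 1#)
        ≤⟨ ⊗-monoˡ 0≼A (⊕-monoˡ (⊝ 1#) (⊗-monoˡ (inj₁ 0≺y) (1≼pow 0≼t (slack G forb)))) ⟩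
      A ⊗ (y ⊗ pow F (1# ⊕ t) (slack G forb) ⊖ 1#) ∎
      where
      A = ⟨x⟩ (r + 0)
      0≼t : 0# ≼ t
      0≼t = inj₁ (inverse-pos 0≺y yt≈1)
      0≼A : 0# ≼ A
      0≼A = inj₁ (falling-pos (r + 0) (sharp-pos (r + 0) 0≺y 0≺y-1 last far))
    value-sharp-bound {suc n} {r} {y} {t} 0≺y yt≈1 0≺y-1 G forb last far = begin
      (y ⊖ 1#) ⊗ (⟨x⟩ r ⊗ value G forb)
        ≈⟨ ⊗-congˡ (value-suc G forb) ⟩
      (y ⊖ 1#) ⊗ (⟨x⟩ (suc r) ⊗ value (tailG G) (openBlock G forb) ⊕ ⟨x⟩ r ⊗ joined-value G forb)
        ≈⟨ ⊗-distribˡ _ _ _ ⟩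
      (y ⊖ 1#) ⊗ (⟨x⟩ (suc r) ⊗ value (tailG G) (openBlock G forb)) ⊕ (y ⊖ 1#) ⊗ (⟨x⟩ r ⊗ joined-value G forb)
        ≤⟨ ⊕-mono (value-sharp-bound 0≺y yt≈1 0≺y-1 (tailG G) (openBlock G forb) last′ far′)
                  (⊗-monoˡ (inj₁ 0≺y-1) (joined-value-bound 0≼t 0≼B G forb λ b →
                     value-bound 0≺y yt≈1 (tailG G) (joinBlock G forb b) λ j j< → far′ j (s≤s j<))) ⟩
      A ⊗ (y ⊗ W ⊖ 1#) ⊕ (y ⊖ 1#) ⊗ (ι p ⊗ (B ⊗ W))
        -- The factor y - 1 completes `B` to `A` exactly, where `value-bound` had only an estimate;
        -- y t = 1 then brings out the factor y.
        ≈⟨ ⊕-congˡ (≈-trans (⊗-congʳ (last′ (r + n) refl))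
             (solve 4 (λ z p B W → z :* (p :* (B :* W)) := p :* (B :* z :* W)) ≈-refl _ (ι p) B W)) ⟩
      A ⊗ (y ⊗ W ⊖ 1#) ⊕ ι p ⊗ (A ⊗ W)
        ≈⟨ ⊕-congˡ (≈-trans (≈-sym (⊗-identityʳ _)) (⊗-congˡ (≈-sym yt≈1))) ⟩
      A ⊗ (y ⊗ W ⊖ 1#) ⊕ ι p ⊗ (A ⊗ W) ⊗ (y ⊗ t)
        ≈⟨ solve 5 (λ A y W p t → A :* (y :* W :- 𝟙) :+ p :* (A :* W) :* (y :* t) :=
                                  A :* (y :* (W :* (𝟙 :+ p :* t)) :- 𝟙)) ≈-refl A y W (ι p) t ⟩
      A ⊗ (y ⊗ (W ⊗ (1# ⊕ ι p ⊗ t)) ⊖ 1#)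
        ≤⟨ ⊗-monoˡ 0≼A (⊕-monoˡ (⊝ 1#) (⊗-monoˡ (inj₁ 0≺y) (pow-slack 0≼t G forb))) ⟩
      A ⊗ (y ⊗ pow F (1# ⊕ t) (slack G forb) ⊖ 1#)
        ≡⟨ cong (λ z → ⟨x⟩ z ⊗ (y ⊗ pow F (1# ⊕ t) (slack G forb) ⊖ 1#)) (+-suc r n) ⟨
      ⟨x⟩ (r + suc n) ⊗ (y ⊗ pow F (1# ⊕ t) (slack G forb) ⊖ 1#) ∎
      where
      d = slack (tailG G) (openBlock G forb)
      p = size (λ b → not (forb b fz))
      A = ⟨x⟩ (suc (r + n))
      B = ⟨x⟩ (r + n)
      W = pow F (1# ⊕ t) d
      last′ : ∀ j → suc j ≡ suc (r + n) → y ⊖ 1# ≈ x ⊖ ι j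
      last′ j e = last j (trans e (sym (+-suc r n)))
      far′ : ∀ j → suc j < suc (r + n) → y ≼ x ⊖ ι j
      far′ j j< = far j (subst (suc j <_) (sym (+-suc r n)) j<)
      pos : ∀ i → i < suc (r + n) → 0# ≺ x ⊖ ι i
      pos = sharp-pos (suc (r + n)) 0≺y 0≺y-1 last′ far′
      0≼t : 0# ≼ t
      0≼t = inj₁ (inverse-pos 0≺y yt≈1)
      0≼A : 0# ≼ A
      0≼A = inj₁ (falling-pos (suc (r + n)) pos)
      0≼B : 0# ≼ B
      0≼B = inj₁ (falling-pos (r + n) λ i i< → pos i (m≤n⇒m≤1+n i<))

    -- Comparison with (x)_k (x - 1)^(n - k).

    -- Induction on j, multiplying by x - 1. With c = k + j, write x - 1 as (x - c - 1) + c in the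
    -- first term and as (x - c) + (c - 1) in the second; the surplus is `D` `f` (c - 1), which is
    -- nonnegative since c ≥ 1.
    tree-lower : ∀ k j → 1 ≤ k → (∀ i → i ≤ k + j → 0# ≺ x ⊖ ι i) →
      ⟨x⟩ (suc (k + j)) ⊕ ι (gap k j) ⊗ ⟨x⟩ (k + j) ≼ ⟨x⟩ (suc k) ⊗ pow F (x ⊖ 1#) j
    tree-lower k zero    1≤k pos = inj₂ (begin-equality
      ⟨x⟩ (suc (k + 0)) ⊕ 0# ⊗ ⟨x⟩ (k + 0)
        ≈⟨ solve 2 (λ a b → a :+ con (+ 0) :* b := a :* 𝟙) ≈-refl _ _ ⟩
      ⟨x⟩ (suc (k + 0)) ⊗ 1#
        ≡⟨ cong (λ z → ⟨x⟩ (suc z) ⊗ 1#) (+-identityʳ k) ⟩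
      ⟨x⟩ (suc k) ⊗ 1# ∎)
    tree-lower k (suc j) 1≤k pos = begin
      ⟨x⟩ (suc (k + suc j)) ⊕ ι (gap k (suc j)) ⊗ ⟨x⟩ (k + suc j)
        ≡⟨ cong (λ z → ⟨x⟩ (suc z) ⊕ ι (gap k (suc j)) ⊗ ⟨x⟩ z) (+-suc k j) ⟩
      ⟨x⟩ (suc (suc c)) ⊕ ι (gap k j + c) ⊗ ⟨x⟩ (suc c)
        ≈⟨ ⊕-congˡ (⊗-congʳ (ι-+ (gap k j) c)) ⟩
      f ⊗ (x ⊖ ι c) ⊗ (x ⊖ (1# ⊕ ι c)) ⊕ (D ⊕ ι c) ⊗ (f ⊗ (x ⊖ ι c))
        ≈⟨ ⊕-identityʳ _ ⟨
      f ⊗ (x ⊖ ι c) ⊗ (x ⊖ (1# ⊕ ι c)) ⊕ (D ⊕ ι c) ⊗ (f ⊗ (x ⊖ ι c)) ⊕ 0#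
        ≤⟨ ⊕-mono ≼-refl (⊗-nonneg (⊗-nonneg (ι-nonneg (gap k j)) 0≼f) 0≼c-1) ⟩
      f ⊗ (x ⊖ ι c) ⊗ (x ⊖ (1# ⊕ ι c)) ⊕ (D ⊕ ι c) ⊗ (f ⊗ (x ⊖ ι c)) ⊕ D ⊗ f ⊗ (ι c ⊖ 1#)
        ≈⟨ solve 4 (λ f x c D → f :* (x :- c) :* (x :- (𝟙 :+ c)) :+ (D :+ c) :* (f :* (x :- c)) :+ D :* f :* (c :- 𝟙) :=
                                (f :* (x :- c) :+ D :* f) :* (x :- 𝟙)) ≈-refl f x (ι c) D ⟩
      (f ⊗ (x ⊖ ι c) ⊕ D ⊗ f) ⊗ (x ⊖ 1#)
        ≤⟨ ⊗-monoʳ 0≼x-1 (tree-lower k j 1≤k λ i i≤ → pos i (≤-trans i≤ (+-monoʳ-≤ k (n≤1+n j)))) ⟩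
      ⟨x⟩ (suc k) ⊗ pow F (x ⊖ 1#) j ⊗ (x ⊖ 1#)
        ≈⟨ ⊗-assoc _ _ _ ⟩
      ⟨x⟩ (suc k) ⊗ pow F (x ⊖ 1#) (suc j) ∎
      where
      c = k + j
      f = ⟨x⟩ c
      D = ι (gap k j)
      0≼f : 0# ≼ f
      0≼f = inj₁ (falling-pos c λ i i<c → pos i (≤-trans (<⇒≤ i<c) (+-monoʳ-≤ k (n≤1+n j))))
      0≼c-1 : 0# ≼ ι c ⊖ 1#
      0≼c-1 = begin
        0#          ≈⟨ ⊝-inverseʳ 1# ⟨
        1# ⊖ 1#     ≈⟨ ⊕-congʳ ι1≈1 ⟨
        ι 1 ⊖ 1#    ≤⟨ ⊕-monoˡ _ (ι-mono (≤-trans 1≤k (m≤m+n k j))) ⟩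
        ι c ⊖ 1#    ∎
      0≼x-1 : 0# ≼ x ⊖ 1#
      0≼x-1 = begin
        0#          <⟨ pos 1 (≤-trans 1≤k (m≤m+n k (suc j))) ⟩
        x ⊖ ι 1     ≈⟨ ⊕-congˡ (⊝-cong ι1≈1) ⟩
        x ⊖ 1#      ∎

    -- After cancelling y - 1 in the sharp bound, both sides are compared with multiples of `Z` =
    -- (x)_(n - 1). What remains is y (1 + t)^e < y + e + 1 ≤ y + D.
    value<tree : ∀ k j → 1 ≤ k → (G : Graph (suc (k + j))) → nonEdges G < gap k j →
      ι (k + j ∸ 1 + gap k j * gap k j) ≺ x →
      0# ≺ ⟨x⟩ (suc k) × evalF F (chromaticPoly G) x ≺ ⟨x⟩ (suc k) ⊗ pow F (x ⊖ 1#) j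
    value<tree k@(suc k′) j 1≤k G e<D large = falling-pos (suc k) (λ i i<k → pos i (≤-trans i<k (s≤s (m≤m+n k j)))) ,
      (begin-strict
        Q                                       ≤⟨ ⊗-cancelˡ 0≺y-1 scaled ⟩
        Z ⊗ (y ⊗ pow F (1# ⊕ t) e ⊖ 1#)         <⟨ ⊗-monoˡ-≺ 0≺Z (⊕-mono-≺ (⊝ 1#) (pow-upper 0≺y yt≈1 e (e[e+1]≺y))) ⟩
        Z ⊗ (y ⊕ ι (suc e) ⊖ 1#)                ≤⟨ ⊗-monoˡ (inj₁ 0≺Z) (⊕-monoˡ (⊝ 1#) (⊕-mono ≼-refl (ι-mono e<D))) ⟩
        Z ⊗ (y ⊕ ι D ⊖ 1#)                      ≈⟨ solve 3 (λ Z y D → Z :* (y :+ D :- 𝟙) := Z :* (y :- 𝟙) :+ D :* Z) ≈-refl Z y (ι D) ⟩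
        Z ⊗ (y ⊖ 1#) ⊕ ι D ⊗ Z                  ≈⟨ ⊕-congʳ (⊗-congˡ (last (k + j) refl)) ⟩
        ⟨x⟩ (suc (k + j)) ⊕ ι D ⊗ Z             ≤⟨ tree-lower k j 1≤k (λ i i≤ → pos i (s≤s i≤)) ⟩
        ⟨x⟩ (suc k) ⊗ pow F (x ⊖ 1#) j          ∎)
      where
      -- The graph has `suc k + j` vertices, so `N` is n - 2 and the last factor of (x)_n is y - 1.
      N = k′ + j
      D = gap k j
      e = nonEdges G
      y = x ⊖ ι N
      Q = evalF F (chromaticPoly G) x
      Z = ⟨x⟩ (k + j)
      D²≺y : ι (D * D) ≺ y
      D²≺y = begin-strict
        ι (D * D)                   ≈⟨ solve 2 (λ a b → a := b :+ a :- b) ≈-refl _ (ι N) ⟩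
        ι N ⊕ ι (D * D) ⊖ ι N       ≈⟨ ⊕-congʳ (ι-+ N (D * D)) ⟨
        ι (N + D * D) ⊖ ι N         <⟨ ⊕-mono-≺ (⊝ ι N) large ⟩
        y                           ∎
      1≺y : 1# ≺ y
      1≺y = begin-strict
        1#           ≈⟨ ι1≈1 ⟨
        -- D exceeds the number of non-edges and is therefore at least 1; this gives y > 1, so that
        -- y - 1 can be cancelled.
        ι 1          ≤⟨ ι-mono (*-mono-≤ (≤-trans (s≤s z≤n) e<D) (≤-trans (s≤s z≤n) e<D)) ⟩
        ι (D * D)    <⟨ D²≺y ⟩
        y            ∎
      0≺y : 0# ≺ y
      0≺y = begin-strict
        0#   <⟨ 0≺1 ⟩
        1#   <⟨ 1≺y ⟩
        y    ∎
      0≺y-1 : 0# ≺ y ⊖ 1#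
      0≺y-1 = ≺⇒0≺⊖ 1≺y
      e[e+1]≺y : ι (suc e * e) ≺ y
      e[e+1]≺y = begin-strict
        ι (suc e * e)   ≤⟨ ι-mono (*-mono-≤ e<D (<⇒≤ e<D)) ⟩
        ι (D * D)       <⟨ D²≺y ⟩
        y               ∎
      y-inverse : Σ Carrier λ t → y ⊗ t ≈ 1#
      y-inverse = inverse y λ y≈0 → ≺-irrefl (≈-sym y≈0) 0≺y
      t = proj₁ y-inverse
      yt≈1 = proj₂ y-inverse
      last : ∀ i → suc i ≡ suc (k + j) → y ⊖ 1# ≈ x ⊖ ι i
      last i refl = solve 2 (λ x s → x :- s :- 𝟙 := x :- (𝟙 :+ s)) ≈-refl x (ι N)
      far : ∀ i → suc i < suc (k + j) → y ≼ x ⊖ ι i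
      far i (s≤s (s≤s i≤N)) = ⊖-antimono x (ι-mono i≤N)
      pos : ∀ i → i < suc (k + j) → 0# ≺ x ⊖ ι i
      pos = sharp-pos (suc (k + j)) 0≺y 0≺y-1 last far
      0≺Z : 0# ≺ Z
      0≺Z = falling-pos (k + j) λ i i< → pos i (m≤n⇒m≤1+n i<)
      scaled : (y ⊖ 1#) ⊗ Q ≼ (y ⊖ 1#) ⊗ (Z ⊗ (y ⊗ pow F (1# ⊕ t) e ⊖ 1#))
      scaled = begin
        (y ⊖ 1#) ⊗ Q
          ≈⟨ ⊗-congˡ (⊗-identityˡ Q) ⟨
        (y ⊖ 1#) ⊗ (1# ⊗ Q)
          ≤⟨ value-sharp-bound 0≺y yt≈1 0≺y-1 G (λ ()) last far ⟩
        Z ⊗ (x ⊖ ι (k + j)) ⊗ (y ⊗ pow F (1# ⊕ t) e ⊖ 1#)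
          ≈⟨ ⊗-congʳ (⊗-congˡ (last (k + j) refl)) ⟨
        Z ⊗ (y ⊖ 1#) ⊗ (y ⊗ pow F (1# ⊕ t) e ⊖ 1#)
          ≈⟨ solve 3 (λ Z u v → Z :* u :* v := u :* (Z :* v)) ≈-refl Z _ _ ⟩
        (y ⊖ 1#) ⊗ (Z ⊗ (y ⊗ pow F (1# ⊕ t) e ⊖ 1#)) ∎

theorem8 : (k n : ℕ) → 4 ≤ k → k ≤ n → (G : Graph n) →
    Connected G → ChromaticNumber G k → ¬ InCstar k n G →
    (P : List ℤ) → IsChromaticPoly G P →
    (F : OrderedField) → (x : OrderedField.Carrier F) →
    OrderedField._<_ F
    (fromℕ F ((n ∸ 2) + ((n C 2 + k) ∸ (k C 2 + n)) * ((n C 2 + k) ∸ (k C 2 + n)))) x →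
    Σ (OrderedField.Carrier F) λ y →
    OrderedField._≈_ F (OrderedField._*_ F (falling F x k) y) (OrderedField.1# F) ×
    OrderedField._<_ F (OrderedField._*_ F y (evalF F P x))
    (pow F (OrderedField._-_ F x (OrderedField.1# F)) (n ∸ k))
theorem8 (suc zero) n (s≤s ()) k≤n
-- The k of the statement is now `suc k`, matching the shifted index of `gap`, and n becomes
-- `suc k + j`.
theorem8 (suc k@(suc k′)) n 4≤k k≤n G conn chrom notC P isP F x large with m≤n⇒∃[o]m+o≡n k≤n
... | j , refl = divide-≺ (proj₁ bounds) (≺-respˡ agree below)
  where
  open FieldBounds F
  -- The truncated subtraction in the statement is exact, because `gap-closed` exhibits the
  -- difference.
  gap≡ : (n C 2 + suc k) ∸ (suc k C 2 + n) ≡ gap k j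
  gap≡ = trans (cong₂ _∸_ (cong (λ z → z + suc k) (sym (gap-closed k j))) (rearrange (suc k C 2) (suc k) j))
               (trans (cong (λ z → z ∸ (suc k C 2 + j + suc k)) (+-assoc (gap k j) _ (suc k)))
                      (m+n∸n≡m (gap k j) (suc k C 2 + j + suc k)))
    where
    rearrange : ∀ c k j → c + (k + j) ≡ c + j + k
    rearrange = solve-∀
  few : nonEdges G < gap k j
  few = +-cancelʳ-< (suc k C 2 + j) (nonEdges G) (gap k j) (begin-strict
    nonEdges G + (suc k C 2 + j)                  ≡⟨ cong (λ z → nonEdges G + (suc k C 2 + z)) (m+n∸m≡n (suc k) j) ⟨
    nonEdges G + (suc k C 2 + (suc k + j ∸ suc k)) <⟨ +-monoʳ-< (nonEdges G) (numEdges-lower-bound 4≤k k≤n G conn chrom notC) ⟩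
    nonEdges G + numEdges G                       ≡⟨ nonEdges+numEdges G ⟩
    n C 2                                         ≡⟨ gap-closed k j ⟨
    gap k j + (suc k C 2 + j)                     ∎)
    where open ≤-Reasoning
  bounds = value<tree x k j (s≤s z≤n) G few
    (subst (λ d → OrderedField._<_ F (fromℕ F (k′ + j + d * d)) x) gap≡ large)
  below = subst (λ i → OrderedField._<_ F (evalF F (chromaticPoly G) x)
                         (OrderedField._*_ F (falling F x (suc k)) (pow F (OrderedField._-_ F x (OrderedField.1# F)) i)))
                (sym (m+n∸m≡n (suc k) j)) (proj₂ bounds)
  -- The given polynomial and the constructed one count the same colourings on ℕ, hence agree at x.
  agree = evalF-unique P (chromaticPoly G) (λ m → trans (isP m) (sym (chromaticPoly-correct G m))) x
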